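{- Let $G$ be an abelian group and let $S$ be a zero-sum free subset of $G$ with $|S|=6$. Then $|\Sigma(S)|=19$ if and only if there exist $x_1,x_2,x_3\in G$ such that $S$ is one of the following: (i) $S=\{x_1,\ x_2,\ x_3,\ x_1+x_3,\ x_2+x_3,\ x_1+x_2+x_3\}$, where $\operatorname{ord}(x_1)=2$ and $2x_2\in\langle x_1\rangle$; (ii) $S=\{x_1,\ x_2,\ 2x_2,\ 3x_2,\ x_1+x_2,\ x_1+2x_2\}$, where $\operatorname{ord}(x_1)=2$; (iii) $S=\{ -2x_1,\ x_1,\ 3x_1,\ 4x_1,\ 5x_1,\ 6x_1\}$, where $\operatorname{ord}(x_1)=20$; (iv) $S=\{ -3x_1,\ x_1,\ 4x_1,\ 5x_1,\ 9x_1,\ 12x_1\}$, where $\operatorname{ord}(x_1)=20$; (v) $S=\{x_1,\ x_2,\ x_1+x_2,\ x_1+2x_2,\ 2x_1+x_2,\ 4x_1+4x_2\}$, where $2x_1=2x_2$ and $\operatorname{ord}(x_1)=\operatorname{ord}(x_2)=10$. (In each case the six listed elements are required to be distinct, since $S$ is a set of size $6$.)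
   Context: $G$ is written additively. For a finite subset $S\subseteq G$, $\Sigma(S)$ denotes the set of all elements $\sum_{g\in T} g$ where $T$ ranges over the nonempty subsets of $S$. $S$ is called zero-sum free if $0\notin\Sigma(S)$. $\operatorname{ord}(g)$ denotes the order of $g\in G$. -}

module Defs where

open import Level using (Level; _⊔_)
open import Algebra.Bundles using (AbelianGroup)
open import Data.Nat using (ℕ; zero; suc; _≤_; _<_)
open import Data.Fin using (Fin)
open import Data.Fin.Subset using (Subset; Nonempty; inside; outside)
open import Data.Vec using (Vec; []; _∷_; lookup)
open import Data.Product using (Σ; ∃; _×_; _,_)
open import Data.Sum using (_⊎_)
open import Relation.Binary.PropositionalEquality using (_≡_)
open import Relation.Nullary using (¬_)
open import Function.Bundles using (_⇔_)

-- Everything is relative to an abelian group G, written additively: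
-- _∙_ is +, ε is 0, _⁻¹ is negation, _≈_ is the group's equality.
module Over {c ℓ : Level} (G : AbelianGroup c ℓ) where
  open AbelianGroup G

  infixr 8 _·_
  _·_ : ℕ → Carrier → Carrier
  zero  · x = ε
  suc n · x = x ∙ (n · x)

  Ord : Carrier → ℕ → Set ℓ
  Ord x n = (1 ≤ n) × (n · x ≈ ε) × (∀ k → 1 ≤ k → k < n → ¬ (k · x ≈ ε))

  InCyclic : Carrier → Carrier → Set ℓ
  InCyclic y x = ∃ λ (n : ℕ) → (y ≈ n · x) ⊎ (y ≈ (n · x) ⁻¹)

  sumOver : ∀ {n} → Subset n → Vec Carrier n → Carrier
  sumOver []            []       = ε
  sumOver (inside ∷ T)  (x ∷ xs) = x ∙ sumOver T xs
  sumOver (outside ∷ T) (x ∷ xs) = sumOver T xs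

  -- pairwise distinct entries (so the vector lists a set of size n)
  Distinct : ∀ {n} → Vec Carrier n → Set ℓ
  Distinct {n} s = ∀ (i j : Fin n) → lookup s i ≈ lookup s j → i ≡ j

  InΣ : ∀ {n} → Vec Carrier n → Carrier → Set ℓ
  InΣ {n} s y = ∃ λ (T : Subset n) → Nonempty T × (y ≈ sumOver T s)

  ZeroSumFree : ∀ {n} → Vec Carrier n → Set ℓ
  ZeroSumFree s = ¬ InΣ s ε

  -- the (≈-closed) predicate P has exactly m elements up to ≈:
  -- there is a bijection between Fin m and the ≈-classes satisfying P
  HasSize : (Carrier → Set ℓ) → ℕ → Set (c ⊔ ℓ)
  HasSize P m = ∃ λ (f : Fin m → Carrier) →
      (∀ i j → f i ≈ f j → i ≡ j)
    × (∀ i → P (f i))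
    × (∀ y → P y → ∃ λ i → y ≈ f i)

  SameSet : ∀ {n m} → Vec Carrier n → Vec Carrier m → Set ℓ
  SameSet s t = (∀ i → ∃ λ j → lookup s i ≈ lookup t j)
              × (∀ j → ∃ λ i → lookup t j ≈ lookup s i)

  IsSet6 : Vec Carrier 6 → Vec Carrier 6 → Set ℓ
  IsSet6 s t = Distinct t × SameSet s t

  neg : ℕ → Carrier → Carrier
  neg k x = (k · x) ⁻¹

  Case1 Case2 Case3 Case4 Case5 : Vec Carrier 6 → Carrier → Carrier → Carrier → Set ℓ
  Case1 s x₁ x₂ x₃ =
    IsSet6 s (x₁ ∷ x₂ ∷ x₃ ∷ (x₁ ∙ x₃) ∷ (x₂ ∙ x₃) ∷ (x₁ ∙ x₂ ∙ x₃) ∷ [])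
    × Ord x₁ 2 × InCyclic (2 · x₂) x₁
  Case2 s x₁ x₂ x₃ =
    IsSet6 s (x₁ ∷ x₂ ∷ (2 · x₂) ∷ (3 · x₂) ∷ (x₁ ∙ x₂) ∷ (x₁ ∙ 2 · x₂) ∷ [])
    × Ord x₁ 2
  Case3 s x₁ x₂ x₃ =
    IsSet6 s (neg 2 x₁ ∷ x₁ ∷ (3 · x₁) ∷ (4 · x₁) ∷ (5 · x₁) ∷ (6 · x₁) ∷ [])
    × Ord x₁ 20
  Case4 s x₁ x₂ x₃ =
    IsSet6 s (neg 3 x₁ ∷ x₁ ∷ (4 · x₁) ∷ (5 · x₁) ∷ (9 · x₁) ∷ (12 · x₁) ∷ [])
    × Ord x₁ 20
  Case5 s x₁ x₂ x₃ =
    IsSet6 s (x₁ ∷ x₂ ∷ (x₁ ∙ x₂) ∷ (x₁ ∙ 2 · x₂) ∷ (2 · x₁ ∙ x₂) ∷ (4 · x₁ ∙ 4 · x₂) ∷ [])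
    × (2 · x₁ ≈ 2 · x₂) × Ord x₁ 10 × Ord x₂ 10

  OneOfCases : Vec Carrier 6 → Set (c ⊔ ℓ)
  OneOfCases s = ∃ λ x₁ → ∃ λ x₂ → ∃ λ x₃ →
    Case1 s x₁ x₂ x₃ ⊎ Case2 s x₁ x₂ x₃ ⊎ Case3 s x₁ x₂ x₃
    ⊎ Case4 s x₁ x₂ x₃ ⊎ Case5 s x₁ x₂ x₃

-- If |Σ(S)| = 19, equality of subset sums of S is decidable, so one may branch on such equalities.
-- Along a branch, the equalities assumed so far span a lattice L of relations in ℤ⁶, while the refuted
-- ones, zero-sum freeness and distinctness give a set N of linear forms that do not vanish at S.
-- A branch ends when L and N show that 21 subset sums (0 included) are pairwise distinct, which
-- contradicts |Σ(S) ∪ {0}| = 20, or that S is one of the listed sets. A permutation of S preserving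
-- L and N carries a refuted equality to a refuted equality; using this, a tree with 255 branchings
-- covers all cases. Conversely, in each case the 63 subset sums are computed in ℤ³ modulo the
-- relations between x₁, x₂ and x₃, and distinct classes are distinct elements by zero-sum freeness.

module Submission where

open import Defs
open import Level using (Level; _⊔_)
open import Algebra.Bundles using (AbelianGroup)
open import Data.Vec as Vec using (Vec; []; _∷_; lookup; tabulate; replicate; zipWith)
open import Function.Bundles using (_⇔_; mk⇔; module Equivalence)
import Algebra.Properties.AbelianGroup as AbelianGroupProperties
import Algebra.Properties.CommutativeMonoid.Sum as CommutativeMonoidSum
import Algebra.Properties.CommutativeSemigroup as CommutativeSemigroupProperties
open import Data.Bool using (Bool; true; false; T; T?; _∧_; if_then_else_)
open import Data.Bool.ListAction using (all; any)
open import Data.Bool.Properties using (T-∧; T-≡)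
open import Data.Empty using (⊥-elim)
open import Data.Fin as Fin using (Fin; zero; suc; toℕ; fromℕ<)
open import Data.Fin.Permutation using (Permutation; permutation)
open import Data.Fin.Properties as Fin using (pigeonhole; suc-injective; toℕ-fromℕ<)
open import Data.Fin.Subset using (Subset; Nonempty; inside; outside; ⁅_⁆; _∈_)
open import Data.Integer as ℤ using (ℤ; +_; -[1+_]; -_)
open import Data.Integer.Properties using ([1+m]⊖[1+n]≡m⊖n)
open import Data.List as List using (List; []; _∷_; _++_)
import Data.List.Membership.Propositional as List
open import Data.List.Membership.Propositional.Properties as List using (∈-allFin; ∈-concatMap⁺; ∈-filter⁺)
open import Data.List.Relation.Unary.All as All using (All; []; _∷_)
open import Data.List.Relation.Unary.All.Properties as All using (all⁺; all-filter)
open import Data.List.Relation.Unary.Any as Any using (here; there)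
open import Data.List.Relation.Unary.Any.Properties using (any⁻)
open import Data.Nat as ℕ using (ℕ; zero; suc; _<ᵇ_; _∸_; _/_; _%_; s≤s; z≤n)
open import Data.Nat.Properties as ℕ using (≤-refl)
open import Data.Product using (∃; _×_; _,_; proj₁; proj₂)
open import Data.Sum using (_⊎_; inj₁; inj₂; [_,_]′)
open import Data.Unit.Polymorphic using (⊤; tt)
open import Data.Vec.Properties using (≡-dec; lookup-map; lookup∘tabulate; []=⇒lookup; lookup⇒[]=)
open import Function.Base using (_∘_)
open import Relation.Binary.PropositionalEquality as ≡ using (_≡_; _≢_; subst; cong)
open import Relation.Nullary using (¬_; Dec; yes; no)
open import Relation.Nullary.Decidable using (⌊_⌋; ¬?; toWitness; map′)
import Relation.Binary.Reasoning.Setoid as SetoidReasoning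

-- Equality in `G` need not be decidable, so nothing is computed in `G` itself. L and N are data in
-- ℤ⁶, the tree is examined by a Boolean function that the type checker evaluates, and the soundness
-- of that function is proved once for every group. All tests rest on normal forms modulo L: two
-- subset sums are distinct as soon as the normal form of their difference is found in N. The
-- symmetries dictate the shape of the soundness proof. A permuted difference evaluated at S is the
-- original difference evaluated at a permuted S, so each branch has to be proved for all vectors
-- that satisfy L and N, not for S alone. The first two branchings come from a count. If no element
-- of S is the sum of two others and no two disjoint pairs have the same sum, then 0, the six
-- elements and the fifteen sums of pairs are 22 distinct elements. Hence a set with 19 sums
-- satisfies a relation of one of these two kinds.

private
  variable
    m n : ℕ
    a : Level
    A : Set a

-- Linear forms and lattices of relations

Form : ℕ → Set
Form = Vec ℤ

infixl 6 _⊕_ _⊝_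
infixr 8 _⊛_

_⊕_ : Form n → Form n → Form n
_⊕_ = zipWith ℤ._+_

⊖_ : Form n → Form n
⊖_ = Vec.map -_

_⊝_ : Form n → Form n → Form n
u ⊝ v = u ⊕ (⊖ v)

_⊛_ : ℕ → Form n → Form n
zero  ⊛ v = replicate _ (+ 0)
suc k ⊛ v = v ⊕ (k ⊛ v)

digit : Bool → ℤ
digit true  = + 1
digit false = + 0

indicator : Subset n → Form n
indicator = Vec.map digit

unit : Fin n → Form n
unit i = indicator ⁅ i ⁆

subsum : Subset m → Vec (Form n) m → Form n
subsum []            []       = replicate _ (+ 0)
subsum (inside ∷ S)  (v ∷ vs) = v ⊕ subsum S vs
subsum (outside ∷ S) (v ∷ vs) = subsum S vs

-- An echelon basis, column by column: pivot a r E has the row (suc a , r) above E.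
data Lattice : ℕ → Set where
  []    : Lattice 0
  free  : Lattice n → Lattice (suc n)
  pivot : ℕ → Form n → Lattice n → Lattice (suc n)

trivial : ∀ n → Lattice n
trivial zero    = []
trivial (suc n) = free (trivial n)

-- Both clauses leave the remainder of the head in [0, a]. For a negative head the multiplier is one
-- larger, as -(k+1) + (⌊k/(a+1)⌋ + 1)(a+1) = a - (k mod (a+1)).
clearHead : ℕ → Form n → Form (suc n) → Form (suc n)
clearHead a r v@(+ k      ∷ _) = ((k / suc a) ⊛ (⊖ (+ suc a ∷ r))) ⊕ v
clearHead a r v@(-[1+ k ] ∷ _) = (suc (k / suc a) ⊛ (+ suc a ∷ r)) ⊕ v

-- Heads are brought into [0, a] at pivots and kept at free columns, so forms congruent modulo the
-- lattice have the same normal form. This turns syntactic lookup in a `Store` into a test modulo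
-- the lattice.
reduce     : Lattice n → Form n → Form n
reduceTail : Lattice n → Form (suc n) → Form (suc n)
reduce []            v       = v
reduce (free E)      v       = reduceTail E v
reduce (pivot a r E) v       = reduceTail E (clearHead a r v)
reduceTail E         (x ∷ v) = x ∷ reduce E v

-- The first argument bounds the number of Euclidean steps; running out of it only loses relations.
insert  : ℕ → Form n → Lattice n → Lattice n
insert′ : ℕ → Form (suc n) → ℕ → Form n → Lattice n → Lattice (suc n)
insert f []              []            = []
insert f v@(_ ∷ _)       (pivot a r E) = insert′ f (clearHead a r v) a r E
insert f (+ zero   ∷ v)  (free E)      = free (insert f v E)
insert f (+ suc k  ∷ v)  (free E)      = pivot k v E
insert f (-[1+ k ] ∷ v)  (free E)      = pivot k (⊖ v) E
insert′ f       (+ zero  ∷ v) a r E = pivot a r (insert f v E)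
-- Euclid's algorithm on the heads: the remainder `suc k` is smaller than `suc a`, becomes the new
-- pivot, and the old row is inserted again.
insert′ (suc f) (+ suc k ∷ v) a r E = insert f (+ suc a ∷ r) (pivot k v E)
insert′ _       _             a r E = pivot a r E

span : List (Form n) → Lattice n
span = List.foldr (insert 1000) (trivial _)

rows : Lattice n → List (Form n)
rows []            = []
rows (free E)      = List.map (+ 0 ∷_) (rows E)
rows (pivot a r E) = (+ suc a ∷ r) ∷ List.map (+ 0 ∷_) (rows E)

isZero : Form n → Bool
isZero []           = true
isZero (+ zero ∷ v) = isZero v
isZero (_ ∷ _)      = false

vanishes : Lattice n → Form n → Bool
vanishes E v = isZero (reduce E v)

-- Finite sets of forms

data Store (n : ℕ) : Set where
  empty : Store n
  node  : ℕ → Form n → Store n → Store n → Store n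

-- Injective on forms with coefficients in [-32, 31]; a collision elsewhere can only make a search fail.
keyFrom : ℕ → Form n → ℕ
keyFrom k []             = k
keyFrom k (+ i      ∷ v) = keyFrom (k ℕ.* 64 ℕ.+ 32 ℕ.+ i) v
keyFrom k (-[1+ i ] ∷ v) = keyFrom (k ℕ.* 64 ℕ.+ (31 ∸ i)) v

key : Form n → ℕ
key = keyFrom 0

search : ℕ → Form n → Store n → Bool
search k v empty          = false
search k v (node j u l r) =
  if k <ᵇ j then search k v l else
  if j <ᵇ k then search k v r else
  ⌊ ≡-dec ℤ._≟_ u v ⌋

put : ℕ → Form n → Store n → Store n
put k v empty          = node k v empty empty
put k v (node j u l r) =
  if k <ᵇ j then node j u (put k v l) r else
  if j <ᵇ k then node j u l (put k v r) else
  node j u l r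

member : Form n → Store n → Bool
member v = search (key v) v

known : Lattice n → Store n → Form n → Bool
known E N v = member (reduce E v) N

putForm : Form n → Store n → Store n
putForm v = put (key v) v

-- Both signs are stored, since the normal forms of `v` and `⊖ v` are in general not negatives of
-- each other and a query may use either orientation of a difference.
add : Lattice n → Form n → Store n → Store n
add E v N = putForm (reduce E (⊖ v)) (putForm (reduce E v) N)

store : Lattice n → List (Form n) → Store n
store E = List.foldr (add E) empty

-- A new relation changes the normal forms, so every stored form is normalised again.
rebuild : Lattice n → Store n → Store n → Store n
rebuild E empty          M = M
rebuild E (node _ v l r) M = rebuild E r (rebuild E l (putForm (reduce E v) M))

everywhere : (Form n → Bool) → Store n → Bool
everywhere p empty          = true
everywhere p (node _ v l r) = p v ∧ everywhere p l ∧ everywhere p r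

forAll forSome : (Fin n → Bool) → Bool
forAll  p = all p (List.allFin _)
forSome p = any p (List.allFin _)

separated : Lattice n → Store n → Vec (Form n) m → Bool
separated E N []       = true
separated E N (v ∷ vs) = forAll (λ j → known E N (v ⊝ lookup vs j)) ∧ separated E N vs

-- Permutations as words in adjacent transpositions

swapAt : ℕ → Vec A n → Vec A n
swapAt zero    (x ∷ y ∷ v) = y ∷ x ∷ v
swapAt (suc k) (x ∷ v)     = x ∷ swapAt k v
swapAt _       v           = v

-- The word is read in opposite orders, so the two are mutually inverse. `act` is applied to forms
-- and `unact` to vectors of group elements; `eval-act` relates them.
act unact : List ℕ → Vec A n → Vec A n
act   []       v = v
act   (k ∷ ks) v = act ks (swapAt k v)
unact []       v = v
unact (k ∷ ks) v = swapAt k (unact ks v)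

-- The test guarantees that `unact g s` satisfies `E` and `N` whenever `s` does.
symmetric : Lattice n → Store n → List ℕ → Bool
symmetric E N g = all (vanishes E ∘ act g) (rows E) ∧ everywhere (known E N ∘ act g) N

-- Adds the orbits of the given forms; running out of the first argument only loses information.
close : ℕ → List (List ℕ) → Lattice n → List (Form n) → Store n → Store n
close zero    gs E vs       N = N
close (suc f) gs E []       N = N
close (suc f) gs E (v ∷ vs) N =
  -- The images of a known form need no visit: for a form of the original store they are known by
  -- `symmetric`, and for an added one they have been queued, up to sign.
  if known E N v then close f gs E vs N
  else close f gs E (List.map (λ g → act g v) gs ++ vs) (add E v N)

-- The extremal configurations

-- One syntax with three readings: as forms in the six elements of S (`fits`), as forms in x₁, x₂,
-- x₃ (`Sizes`), and in the group, where `⟦_⟧` unfolds to the very expressions of the theorem.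
data Term : Set where
  var : Fin 3 → Term
  _⊞_ : Term → Term → Term
  _⊡_ : ℕ → Term → Term
  ⊟_  : Term → Term

infixl 6 _⊞_
infixr 8 _⊡_ ⊟_

form : Vec (Form n) 3 → Term → Form n
form X (var i) = lookup X i
form X (t ⊞ u) = form X t ⊕ form X u
form X (k ⊡ t) = k ⊛ form X t
form X (⊟ t)   = ⊖ form X t

-- Case (i) is split according to whether 2 x₂ is 0 or x₁.
data Shape : Set where
  caseI₀ caseI₁ caseII caseIII caseIV caseV : Shape

private
  x₁ x₂ x₃ : Term
  x₁ = var zero
  x₂ = var (suc zero)
  x₃ = var (suc (suc zero))

elements : Shape → Vec Term 6
elements caseI₀  = x₁ ∷ x₂ ∷ x₃ ∷ x₁ ⊞ x₃ ∷ x₂ ⊞ x₃ ∷ x₁ ⊞ x₂ ⊞ x₃ ∷ []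
elements caseI₁  = elements caseI₀
elements caseII  = x₁ ∷ x₂ ∷ 2 ⊡ x₂ ∷ 3 ⊡ x₂ ∷ x₁ ⊞ x₂ ∷ x₁ ⊞ 2 ⊡ x₂ ∷ []
elements caseIII = ⊟ (2 ⊡ x₁) ∷ x₁ ∷ 3 ⊡ x₁ ∷ 4 ⊡ x₁ ∷ 5 ⊡ x₁ ∷ 6 ⊡ x₁ ∷ []
elements caseIV  = ⊟ (3 ⊡ x₁) ∷ x₁ ∷ 4 ⊡ x₁ ∷ 5 ⊡ x₁ ∷ 9 ⊡ x₁ ∷ 12 ⊡ x₁ ∷ []
elements caseV   = x₁ ∷ x₂ ∷ x₁ ⊞ x₂ ∷ x₁ ⊞ 2 ⊡ x₂ ∷ 2 ⊡ x₁ ⊞ x₂ ∷ 4 ⊡ x₁ ⊞ 4 ⊡ x₂ ∷ []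

-- The right-hand sides `0 ⊡ x₁` and `1 ⊡ x₁` are written as multiples so that they serve as they
-- stand for `InCyclic`, with witnesses 0 and 1.
relations : Shape → List (Term × Term)
relations caseI₀  = (2 ⊡ x₂ , 0 ⊡ x₁) ∷ []
relations caseI₁  = (2 ⊡ x₂ , 1 ⊡ x₁) ∷ []
relations caseII  = []
relations caseIII = []
relations caseIV  = []
relations caseV   = (2 ⊡ x₁ , 2 ⊡ x₂) ∷ []

-- The entry (t , k) stands for ord(t) = k + 1.
orders : Shape → List (Term × ℕ)
orders caseI₀  = (x₁ , 1) ∷ []
orders caseI₁  = (x₁ , 1) ∷ []
orders caseII  = (x₁ , 1) ∷ []
orders caseIII = (x₁ , 19) ∷ []
orders caseIV  = (x₁ , 19) ∷ []
orders caseV   = (x₁ , 9) ∷ (x₂ , 9) ∷ []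

listed : Lattice n → Vec (Form n) n → Bool
listed E f =
    forAll (λ i → forSome (λ j → vanishes E (unit i ⊝ lookup f j)))
  ∧ forAll (λ j → forSome (λ i → vanishes E (lookup f j ⊝ unit i)))

related : Shape → Vec (Form n) 3 → Lattice n → Bool
related sh X E = all (λ (t , u) → vanishes E (form X t ⊝ form X u)) (relations sh)

ordered : Shape → Vec (Form n) 3 → Lattice n → Store n → Bool
ordered sh X E N = all
  (λ (t , k) → vanishes E (suc k ⊛ form X t)
             ∧ forAll {n = k} (λ i → known E N (suc (toℕ i) ⊛ form X t)))
  (orders sh)

fits : Shape → Vec (Form 6) 3 → Lattice 6 → Store 6 → Bool
fits sh X E N =
    listed E (Vec.map (form X) (elements sh))
  ∧ separated E N (Vec.map (form X) (elements sh))
  ∧ related sh X E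
  ∧ ordered sh X E N

-- Certificates

bit : ℕ → Bool
bit zero    = outside
bit (suc _) = inside

-- Subsets are encoded in binary, the element 0 being the least significant bit.
decode : ∀ n → ℕ → Subset n
decode zero    k = []
decode (suc n) k = bit (k % 2) ∷ decode n (k / 2)

-- split S T gs p q: p treats the case ΣS = ΣT; the words gs are symmetries of the current
-- knowledge, so that in q all images of ΣS ≠ ΣT under the group they generate may be used.
-- clique Ss: the sums over these 21 subsets are pairwise distinct.
-- leaf sh X: the set has the shape sh, with x₁, x₂, x₃ the sums over the subsets X.
data Tree : Set where
  split  : ℕ → ℕ → List (List ℕ) → Tree → Tree → Tree
  clique : Vec ℕ 21 → Tree
  leaf   : Shape → Vec ℕ 3 → Tree

check       : Tree → Lattice 6 → Store 6 → Bool
checkEqual  : Tree → Lattice 6 → Store 6 → Bool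
check (split S T gs p q) E N =
    checkEqual p (insert 1000 (indicator (decode 6 S) ⊝ indicator (decode 6 T)) E) N
  -- Tested for the knowledge before the split: the treatment `p` of the equality is transported
  -- between vectors satisfying `E` and `N`.
  ∧ all (symmetric E N) gs
  ∧ check q E (close 1000 gs E ((indicator (decode 6 S) ⊝ indicator (decode 6 T)) ∷ []) N)
check (clique Ss) E N = separated E N (Vec.map (indicator ∘ decode 6) Ss)
check (leaf sh X) E N = fits sh (Vec.map (indicator ∘ decode 6) X) E N
checkEqual p E N = check p E (rebuild E N empty)

occupied : Subset n → Bool
occupied []            = false
occupied (inside  ∷ S) = true
occupied (outside ∷ S) = occupied S

-- The first element varies fastest; together with key this keeps the search trees balanced.
subsets : ∀ n → List (Subset n)
subsets zero    = [] ∷ []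
subsets (suc n) = List.concatMap (λ S → (outside ∷ S) ∷ (inside ∷ S) ∷ []) (subsets n)

occupiedSubsets : ∀ n → List (Subset n)
occupiedSubsets n = List.filter (T? ∘ occupied) (subsets n)

distinctPairs : ∀ n → List (Fin n × Fin n)
distinctPairs n = List.filter (λ (i , j) → ¬? (i Fin.≟ j)) (List.cartesianProduct (List.allFin n) (List.allFin n))

initial : ∀ n → Store n
initial n = store (trivial n)
  (List.map indicator (occupiedSubsets n) ++ List.map (λ (i , j) → unit i ⊝ unit j) (distinctPairs n))

-- Counting subset sums in the extremal configurations

representatives : Shape → Vec ℕ 19
representatives caseI₀  = 1 ∷ 2 ∷ 3 ∷ 4 ∷ 5 ∷ 6 ∷ 7 ∷ 12 ∷ 13 ∷ 14 ∷ 15 ∷ 28 ∷ 29 ∷ 30 ∷ 31 ∷ 60 ∷ 61 ∷ 62 ∷ 63 ∷ []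
representatives caseI₁  = 1 ∷ 2 ∷ 3 ∷ 4 ∷ 5 ∷ 6 ∷ 7 ∷ 12 ∷ 13 ∷ 14 ∷ 15 ∷ 28 ∷ 29 ∷ 30 ∷ 31 ∷ 60 ∷ 61 ∷ 62 ∷ 63 ∷ []
representatives caseII  = 1 ∷ 2 ∷ 3 ∷ 4 ∷ 5 ∷ 6 ∷ 7 ∷ 10 ∷ 11 ∷ 12 ∷ 13 ∷ 14 ∷ 15 ∷ 30 ∷ 31 ∷ 46 ∷ 47 ∷ 62 ∷ 63 ∷ []
representatives caseIII = 1 ∷ 2 ∷ 3 ∷ 4 ∷ 6 ∷ 7 ∷ 10 ∷ 12 ∷ 14 ∷ 15 ∷ 22 ∷ 26 ∷ 28 ∷ 30 ∷ 31 ∷ 46 ∷ 54 ∷ 58 ∷ 63 ∷ []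
representatives caseIV  = 1 ∷ 2 ∷ 3 ∷ 4 ∷ 6 ∷ 7 ∷ 10 ∷ 11 ∷ 12 ∷ 14 ∷ 15 ∷ 20 ∷ 22 ∷ 23 ∷ 26 ∷ 27 ∷ 30 ∷ 31 ∷ 63 ∷ []
representatives caseV   = 1 ∷ 2 ∷ 3 ∷ 5 ∷ 6 ∷ 7 ∷ 10 ∷ 11 ∷ 13 ∷ 14 ∷ 15 ∷ 19 ∷ 23 ∷ 27 ∷ 29 ∷ 30 ∷ 31 ∷ 39 ∷ 63 ∷ []

-- A difference of two representatives is, modulo the relations, plus or minus a sum over a nonempty
-- subset. This is why zero-sum freeness, recorded in `nonzero`, separates them. For `caseIII`,
-- `caseIV` and `caseV` the 19 classes are all nonzero elements of a group of order 20.
module Sizes {m k} (es : Vec Term m) (rels : List (Term × Term)) (ords : List (Term × ℕ)) (reps : Vec ℕ k) where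
  units : Vec (Form 3) 3
  units = tabulate unit

  forms : Vec (Form 3) m
  forms = Vec.map (form units) es

  sums : Subset m → Form 3
  sums S = subsum S forms

  basis : Lattice 3
  basis = span (List.map (λ (t , u) → form units t ⊝ form units u) rels
             ++ List.map (λ (t , k) → suc k ⊛ form units t) ords)

  nonzero : Store 3
  nonzero = store basis (List.map sums (occupiedSubsets m))

  representative : Fin k → Subset m
  representative i = decode m (lookup reps i)

  represented : Subset m → Bool
  represented S = forSome (λ i → vanishes basis (sums S ⊝ sums (representative i)))

  sized : Bool
  sized = separated basis nonzero (tabulate (sums ∘ representative))
        ∧ forAll (occupied ∘ representative)
        ∧ all represented (occupiedSubsets m)

Sized : Shape → Set
Sized sh = Sizes.sized (elements sh) (relations sh) (orders sh) (representatives sh) ≡ true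

-- Nonempty subsets, Boolean quantifiers and transpositions

nonempty⇒occupied : (S : Subset n) → Nonempty S → T (occupied S)
nonempty⇒occupied (inside  ∷ S) _                  = _
nonempty⇒occupied (outside ∷ S) (suc i , Vec.there i∈S) = nonempty⇒occupied S (i , i∈S)

occupied⇒nonempty : (S : Subset n) → T (occupied S) → Nonempty S
occupied⇒nonempty (inside  ∷ S) _ = zero , Vec.here
occupied⇒nonempty (outside ∷ S) p = let i , i∈S = occupied⇒nonempty S p in suc i , Vec.there i∈S

∈-subsets : (S : Subset n) → S List.∈ subsets n
∈-subsets []      = here ≡.refl
∈-subsets (b ∷ S) = ∈-concatMap⁺ _ (Any.map (λ where ≡.refl → side b) (∈-subsets S))
  where
  side : ∀ b {S : Subset n} → (b ∷ S) List.∈ (outside ∷ S) ∷ (inside ∷ S) ∷ []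
  side outside = here ≡.refl
  side inside  = there (here ≡.refl)

from-true : ∀ {b} → b ≡ true → T b
from-true = Equivalence.from T-≡

T-∧-split : ∀ x {y} → T (x ∧ y) → T x × T y
T-∧-split x = Equivalence.to (T-∧ {x})

forAll-sound : (p : Fin n → Bool) → T (forAll p) → ∀ i → T (p i)
forAll-sound p h i = All.lookup (all⁺ p _ h) (∈-allFin i)

forSome-sound : (p : Fin n → Bool) → T (forSome p) → ∃ λ i → T (p i)
forSome-sound p h = Any.satisfied (any⁻ p (List.allFin _) h)

map-swapAt : ∀ {b} {B : Set b} (f : A → B) k (v : Vec A n) → Vec.map f (swapAt k v) ≡ swapAt k (Vec.map f v)
map-swapAt f zero    (x ∷ y ∷ v) = ≡.refl
map-swapAt f zero    []          = ≡.refl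
map-swapAt f zero    (x ∷ [])    = ≡.refl
map-swapAt f (suc k) []          = ≡.refl
map-swapAt f (suc k) (x ∷ v)     = cong (f x ∷_) (map-swapAt f k v)

swapIndex : ℕ → Fin n → Fin n
swapIndex {suc (suc _)} zero    zero          = suc zero
swapIndex {suc (suc _)} zero    (suc zero)    = zero
swapIndex {suc (suc _)} zero    (suc (suc i)) = suc (suc i)
swapIndex {suc zero}    zero    i             = i
swapIndex               (suc k) zero          = zero
swapIndex               (suc k) (suc i)       = suc (swapIndex k i)

lookup-swapAt : ∀ k (v : Vec A n) i → lookup (swapAt k v) i ≡ lookup v (swapIndex k i)
lookup-swapAt zero    (x ∷ y ∷ v) zero          = ≡.refl
lookup-swapAt zero    (x ∷ y ∷ v) (suc zero)    = ≡.refl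
lookup-swapAt zero    (x ∷ y ∷ v) (suc (suc i)) = ≡.refl
lookup-swapAt zero    (x ∷ [])    i             = ≡.refl
lookup-swapAt (suc k) (x ∷ v)     zero          = ≡.refl
lookup-swapAt (suc k) (x ∷ v)     (suc i)       = lookup-swapAt k v i

swapIndex-involutive : ∀ k (i : Fin n) → swapIndex k (swapIndex k i) ≡ i
swapIndex-involutive {suc (suc _)} zero    zero          = ≡.refl
swapIndex-involutive {suc (suc _)} zero    (suc zero)    = ≡.refl
swapIndex-involutive {suc (suc _)} zero    (suc (suc i)) = ≡.refl
swapIndex-involutive {suc zero}    zero    i             = ≡.refl
swapIndex-involutive               (suc k) zero          = ≡.refl
swapIndex-involutive               (suc k) (suc i)       = cong suc (swapIndex-involutive k i)

module Soundness {c ℓ} (G : AbelianGroup c ℓ) where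
  open AbelianGroup G hiding (_-_)
  open Over G
  open AbelianGroupProperties G using (⁻¹-∙-comm; ⁻¹-involutive; ε⁻¹≈ε; inverseʳ-unique; x≈y⇒x∙y⁻¹≈ε; x∙y⁻¹≈ε⇒x≈y)
  open CommutativeSemigroupProperties commutativeSemigroup using (interchange; x∙yz≈y∙xz)
  open SetoidReasoning setoid

  -- Integer multiples and evaluation of forms in the group

  infixr 8 _⋆_
  _⋆_ : ℤ → Carrier → Carrier
  (+ k)    ⋆ x = k · x
  -[1+ k ] ⋆ x = (suc k · x) ⁻¹

  ·-homo-+ : ∀ i j x → (i ℕ.+ j) · x ≈ i · x ∙ j · x
  ·-homo-+ zero    j x = sym (identityˡ _)
  ·-homo-+ (suc i) j x = trans (∙-congˡ (·-homo-+ i j x)) (sym (assoc _ _ _))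

  ·-ε : ∀ k {x} → x ≈ ε → k · x ≈ ε
  ·-ε zero    x≈ε = refl
  ·-ε (suc k) x≈ε = trans (∙-cong x≈ε (·-ε k x≈ε)) (identityˡ ε)

  ·-cong : ∀ k {x y} → x ≈ y → k · x ≈ k · y
  ·-cong zero    x≈y = refl
  ·-cong (suc k) x≈y = ∙-cong x≈y (·-cong k x≈y)

  -- The induction cancels one copy of `x` on each side by inserting `x ∙ x ⁻¹`. It settles addition
  -- of integers of opposite signs, which is defined through `ℤ._⊖_`.
  ⋆-⊖ : ∀ i j x → (i ℤ.⊖ j) ⋆ x ≈ i · x ∙ (j · x) ⁻¹
  ⋆-⊖ i       zero    x = sym (trans (∙-congˡ ε⁻¹≈ε) (identityʳ _))
  ⋆-⊖ zero    (suc j) x = sym (identityˡ _)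
  ⋆-⊖ (suc i) (suc j) x = begin
    (suc i ℤ.⊖ suc j) ⋆ x                ≡⟨ cong (_⋆ x) ([1+m]⊖[1+n]≡m⊖n i j) ⟩
    (i ℤ.⊖ j) ⋆ x                        ≈⟨ ⋆-⊖ i j x ⟩
    i · x ∙ (j · x) ⁻¹                   ≈⟨ identityˡ _ ⟨
    ε ∙ (i · x ∙ (j · x) ⁻¹)             ≈⟨ ∙-congʳ (inverseʳ x) ⟨
    (x ∙ x ⁻¹) ∙ (i · x ∙ (j · x) ⁻¹)    ≈⟨ interchange _ _ _ _ ⟩
    (x ∙ i · x) ∙ (x ⁻¹ ∙ (j · x) ⁻¹)    ≈⟨ ∙-congˡ (⁻¹-∙-comm _ _) ⟩
    suc i · x ∙ (suc j · x) ⁻¹           ∎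

  ⋆-homo-+ : ∀ i j x → (i ℤ.+ j) ⋆ x ≈ i ⋆ x ∙ j ⋆ x
  ⋆-homo-+ (+ i)    (+ j)    x = ·-homo-+ i j x
  ⋆-homo-+ (+ i)    -[1+ j ] x = ⋆-⊖ i (suc j) x
  ⋆-homo-+ -[1+ i ] (+ j)    x = trans (⋆-⊖ j (suc i) x) (comm _ _)
  ⋆-homo-+ -[1+ i ] -[1+ j ] x = begin
    (suc (suc (i ℕ.+ j)) · x) ⁻¹       ≡⟨ cong (λ k → (suc k · x) ⁻¹) (≡.sym (ℕ.+-suc i j)) ⟩
    ((suc i ℕ.+ suc j) · x) ⁻¹         ≈⟨ ⁻¹-cong (·-homo-+ (suc i) (suc j) x) ⟩
    (suc i · x ∙ suc j · x) ⁻¹         ≈⟨ ⁻¹-∙-comm _ _ ⟨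
    (suc i · x) ⁻¹ ∙ (suc j · x) ⁻¹    ∎

  ⋆-homo-- : ∀ i x → (- i) ⋆ x ≈ (i ⋆ x) ⁻¹
  ⋆-homo-- (+ zero)  x = sym ε⁻¹≈ε
  ⋆-homo-- (+ suc i) x = refl
  ⋆-homo-- -[1+ i ]  x = sym (⁻¹-involutive _)

  eval : Vec Carrier n → Form n → Carrier
  eval []      []      = ε
  eval (x ∷ s) (i ∷ v) = i ⋆ x ∙ eval s v

  eval-zeros : (s : Vec Carrier n) → eval s (replicate n (+ 0)) ≈ ε
  eval-zeros []      = refl
  eval-zeros (x ∷ s) = trans (identityˡ _) (eval-zeros s)

  eval-⊕ : (s : Vec Carrier n) (u v : Form n) → eval s (u ⊕ v) ≈ eval s u ∙ eval s v
  eval-⊕ []      []      []      = sym (identityˡ ε)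
  eval-⊕ (x ∷ s) (i ∷ u) (j ∷ v) = trans (∙-cong (⋆-homo-+ i j x) (eval-⊕ s u v)) (interchange _ _ _ _)

  eval-⊖ : (s : Vec Carrier n) (v : Form n) → eval s (⊖ v) ≈ (eval s v) ⁻¹
  eval-⊖ []      []      = sym ε⁻¹≈ε
  eval-⊖ (x ∷ s) (i ∷ v) = trans (∙-cong (⋆-homo-- i x) (eval-⊖ s v)) (⁻¹-∙-comm _ _)

  eval-⊝ : (s : Vec Carrier n) (u v : Form n) → eval s (u ⊝ v) ≈ eval s u ∙ (eval s v) ⁻¹
  eval-⊝ s u v = trans (eval-⊕ s u (⊖ v)) (∙-congˡ (eval-⊖ s v))

  eval-⊛ : (s : Vec Carrier n) (k : ℕ) (v : Form n) → eval s (k ⊛ v) ≈ k · eval s v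
  eval-⊛ s zero    v = eval-zeros s
  eval-⊛ s (suc k) v = trans (eval-⊕ s v (k ⊛ v)) (∙-congˡ (eval-⊛ s k v))

  ⊝-zero : (s : Vec Carrier n) (u v : Form n) → eval s (u ⊝ v) ≈ ε → eval s u ≈ eval s v
  ⊝-zero s u v h = x∙y⁻¹≈ε⇒x≈y _ _ (trans (sym (eval-⊝ s u v)) h)

  zero-⊝ : (s : Vec Carrier n) (u v : Form n) → eval s u ≈ eval s v → eval s (u ⊝ v) ≈ ε
  zero-⊝ s u v h = trans (eval-⊝ s u v) (x≈y⇒x∙y⁻¹≈ε h)

  eval-indicator : (s : Vec Carrier n) (S : Subset n) → eval s (indicator S) ≈ sumOver S s
  eval-indicator []      []            = refl
  eval-indicator (x ∷ s) (inside ∷ S)  = ∙-cong (identityʳ x) (eval-indicator s S)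
  eval-indicator (x ∷ s) (outside ∷ S) = trans (identityˡ _) (eval-indicator s S)

  eval-unit : (s : Vec Carrier n) (i : Fin n) → eval s (unit i) ≈ lookup s i
  eval-unit (x ∷ s) zero    = trans (∙-cong (identityʳ x) (eval-⊥ s)) (identityʳ x)
    where
    eval-⊥ : (s : Vec Carrier n) → eval s (indicator (replicate n outside)) ≈ ε
    eval-⊥ []      = refl
    eval-⊥ (x ∷ s) = trans (identityˡ _) (eval-⊥ s)
  eval-unit (x ∷ s) (suc i) = trans (identityˡ _) (eval-unit s i)

  eval-subsum : (s : Vec Carrier n) (t : Vec Carrier m) (f : Vec (Form n) m) →
    (∀ j → lookup t j ≈ eval s (lookup f j)) → (S : Subset m) → eval s (subsum S f) ≈ sumOver S t
  eval-subsum s []      []      h []            = eval-zeros s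
  eval-subsum s (x ∷ t) (v ∷ f) h (inside ∷ S)  =
    trans (eval-⊕ s v (subsum S f)) (∙-cong (sym (h zero)) (eval-subsum s t f (h ∘ suc) S))
  eval-subsum s (x ∷ t) (v ∷ f) h (outside ∷ S) = eval-subsum s t f (h ∘ suc) S

  eval-swapAt : ∀ k (s : Vec Carrier n) (v : Form n) → eval s (swapAt k v) ≈ eval (swapAt k s) v
  eval-swapAt zero    []          []          = refl
  eval-swapAt zero    (x ∷ [])    (i ∷ [])    = refl
  eval-swapAt zero    (x ∷ y ∷ s) (i ∷ j ∷ v) = x∙yz≈y∙xz _ _ _
  eval-swapAt (suc k) []          []          = refl
  eval-swapAt (suc k) (x ∷ s)     (i ∷ v)     = ∙-congˡ (eval-swapAt k s v)

  -- Adjacent swaps are self-adjoint for the pairing `eval`, so a word passes to the other argument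
  -- in reverse order.
  eval-act : ∀ g (s : Vec Carrier n) (v : Form n) → eval s (act g v) ≈ eval (unact g s) v
  eval-act []       s v = refl
  eval-act (k ∷ ks) s v = trans (eval-act ks s (swapAt k v)) (eval-swapAt k (unact ks s) v)

  -- Relations that hold, and forms that do not vanish, at a vector

  Vanish : Vec Carrier n → Lattice n → Set ℓ
  Vanish []      []            = ⊤
  Vanish (x ∷ s) (free E)      = Vanish s E
  Vanish (x ∷ s) (pivot a r E) = eval (x ∷ s) (+ suc a ∷ r) ≈ ε × Vanish s E

  vanish-trivial : (s : Vec Carrier n) → Vanish s (trivial n)
  vanish-trivial []      = tt
  vanish-trivial (x ∷ s) = vanish-trivial s

  clearHead-sound : ∀ a r (s : Vec Carrier (suc n)) → eval s (+ suc a ∷ r) ≈ ε →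
    ∀ v → eval s (clearHead a r v) ≈ eval s v
  clearHead-sound a r s h v@(+ k ∷ _) = begin
    eval s ((k / suc a) ⊛ (⊖ row) ⊕ v)             ≈⟨ eval-⊕ s ((k / suc a) ⊛ (⊖ row)) v ⟩
    eval s ((k / suc a) ⊛ (⊖ row)) ∙ eval s v      ≈⟨ ∙-congʳ (eval-⊛ s (k / suc a) (⊖ row)) ⟩
    (k / suc a) · eval s (⊖ row) ∙ eval s v        ≈⟨ ∙-congʳ (·-ε (k / suc a) -row≈ε) ⟩
    ε ∙ eval s v                                   ≈⟨ identityˡ _ ⟩
    eval s v                                       ∎
    where
    row = + suc a ∷ r
    -row≈ε = trans (eval-⊖ s row) (trans (⁻¹-cong h) ε⁻¹≈ε)
  clearHead-sound a r s h v@(-[1+ k ] ∷ _) = begin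
    eval s (suc (k / suc a) ⊛ row ⊕ v)             ≈⟨ eval-⊕ s (suc (k / suc a) ⊛ row) v ⟩
    eval s (suc (k / suc a) ⊛ row) ∙ eval s v      ≈⟨ ∙-congʳ (eval-⊛ s (suc (k / suc a)) row) ⟩
    suc (k / suc a) · eval s row ∙ eval s v        ≈⟨ ∙-congʳ (·-ε (suc (k / suc a)) h) ⟩
    ε ∙ eval s v                                   ≈⟨ identityˡ _ ⟩
    eval s v                                       ∎
    where row = + suc a ∷ r

  reduce-sound : (E : Lattice n) (s : Vec Carrier n) → Vanish s E → ∀ v → eval s (reduce E v) ≈ eval s v
  reduceTail-sound : (E : Lattice n) (s : Vec Carrier (suc n)) → Vanish (Vec.tail s) E →
    ∀ v → eval s (reduceTail E v) ≈ eval s v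
  reduce-sound []            []      _       []  = refl
  reduce-sound (free E)      s@(_ ∷ _) h       v = reduceTail-sound E s h v
  reduce-sound (pivot a r E) s@(_ ∷ _) (r₀ , h) v =
    trans (reduceTail-sound E s h (clearHead a r v)) (clearHead-sound a r s r₀ v)
  reduceTail-sound E (x ∷ s) h (i ∷ v) = ∙-congˡ (reduce-sound E s h v)

  -- Every row produced is an integer combination of `v` and the old rows, and an exhausted bound
  -- keeps only old rows.
  insert-sound : ∀ f v (E : Lattice n) (s : Vec Carrier n) → eval s v ≈ ε → Vanish s E → Vanish s (insert f v E)
  insert′-sound : ∀ f v a r (E : Lattice n) x (s : Vec Carrier n) → eval (x ∷ s) v ≈ ε →
    eval (x ∷ s) (+ suc a ∷ r) ≈ ε → Vanish s E → Vanish (x ∷ s) (insert′ f v a r E)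
  insert-sound f []               []            []      h t        = t
  insert-sound f (+ zero   ∷ v)   (free E)      (x ∷ s) h t        =
    insert-sound f v E s (trans (sym (identityˡ _)) h) t
  insert-sound f (+ suc k  ∷ v)   (free E)      (x ∷ s) h t        = h , t
  insert-sound f (-[1+ k ] ∷ v)   (free E)      (x ∷ s) h t        =
    trans (eval-⊖ (x ∷ s) (-[1+ k ] ∷ v)) (trans (⁻¹-cong h) ε⁻¹≈ε) , t
  insert-sound f v@(_ ∷ _)        (pivot a r E) (x ∷ s) h (r₀ , t) =
    insert′-sound f (clearHead a r v) a r E x s (trans (clearHead-sound a r (x ∷ s) r₀ v) h) r₀ t
  insert′-sound f       (+ zero  ∷ v) a r E x s h r₀ t = r₀ , insert-sound f v E s (trans (sym (identityˡ _)) h) t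
  insert′-sound (suc f) (+ suc k ∷ v) a r E x s h r₀ t =
    insert-sound f (+ suc a ∷ r) (pivot k v E) (x ∷ s) r₀ (h , t)
  insert′-sound zero    (+ suc k ∷ v)  a r E x s h r₀ t = r₀ , t
  insert′-sound zero    (-[1+ k ] ∷ v) a r E x s h r₀ t = r₀ , t
  insert′-sound (suc f) (-[1+ k ] ∷ v) a r E x s h r₀ t = r₀ , t

  span-sound : (s : Vec Carrier n) {vs : List (Form n)} → All (λ v → eval s v ≈ ε) vs → Vanish s (span vs)
  span-sound s []       = vanish-trivial s
  span-sound s (h ∷ hs) = insert-sound 1000 _ _ s h (span-sound s hs)

  rows-sound : (E : Lattice n) (s : Vec Carrier n) → All (λ v → eval s v ≈ ε) (rows E) → Vanish s E
  rows-sound []            []      _        = tt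
  rows-sound (free E)      (x ∷ s) hs       = rows-sound E s (All.map (trans (sym (identityˡ _))) (All.map⁻ hs))
  rows-sound (pivot a r E) (x ∷ s) (h ∷ hs) =
    h , rows-sound E s (All.map (trans (sym (identityˡ _))) (All.map⁻ hs))

  isZero-sound : (s : Vec Carrier n) (v : Form n) → T (isZero v) → eval s v ≈ ε
  isZero-sound []      []           _ = refl
  isZero-sound (x ∷ s) (+ zero ∷ v) h = trans (identityˡ _) (isZero-sound s v h)

  vanishes-sound : (E : Lattice n) (s : Vec Carrier n) → Vanish s E → ∀ v → T (vanishes E v) → eval s v ≈ ε
  vanishes-sound E s V v h = trans (sym (reduce-sound E s V v)) (isZero-sound s (reduce E v) h)

  Avoid : Vec Carrier n → Store n → Set ℓ
  Avoid s empty          = ⊤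
  Avoid s (node _ v l r) = ¬ eval s v ≈ ε × Avoid s l × Avoid s r

  -- Keys only steer the descent: a hit ends with a decided equality of forms, along which
  -- nonvanishing is transported.
  search-sound : ∀ k v (N : Store n) s → Avoid s N → T (search k v N) → ¬ eval s v ≈ ε
  search-sound k v (node j u l r) s (h , hl , hr) p with k <ᵇ j | j <ᵇ k
  ... | true  | _     = search-sound k v l s hl p
  ... | false | true  = search-sound k v r s hr p
  ... | false | false = subst (λ w → ¬ eval s w ≈ ε) (toWitness {a? = ≡-dec ℤ._≟_ u v} p) h

  put-sound : ∀ k v (N : Store n) s → ¬ eval s v ≈ ε → Avoid s N → Avoid s (put k v N)
  put-sound k v empty          s h _ = h , tt , tt
  put-sound k v (node j u l r) s h (hu , hl , hr) with k <ᵇ j | j <ᵇ k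
  ... | true  | _     = hu , put-sound k v l s h hl , hr
  ... | false | true  = hu , hl , put-sound k v r s h hr
  ... | false | false = hu , hl , hr

  everywhere-sound : (p : Form n → Bool) (N : Store n) (s : Vec Carrier n) →
    (∀ v → T (p v) → ¬ eval s v ≈ ε) → T (everywhere p N) → Avoid s N
  everywhere-sound p empty          s h _ = tt
  everywhere-sound p (node _ v l r) s h q =
    let qv , q′ = T-∧-split (p v) q
        ql , qr = T-∧-split (everywhere p l) q′
    in h v qv , everywhere-sound p l s h ql , everywhere-sound p r s h qr

  module _ (E : Lattice n) (s : Vec Carrier n) (V : Vanish s E) where

    known-sound : ∀ N v → Avoid s N → T (known E N v) → ¬ eval s v ≈ ε
    known-sound N v h p = search-sound _ (reduce E v) N s h p ∘ trans (reduce-sound E s V v)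

    putForm-sound : ∀ v N → ¬ eval s v ≈ ε → Avoid s N → Avoid s (putForm (reduce E v) N)
    putForm-sound v N h = put-sound _ (reduce E v) N s (h ∘ trans (sym (reduce-sound E s V v)))

    add-sound : ∀ v N → ¬ eval s v ≈ ε → Avoid s N → Avoid s (add E v N)
    add-sound v N h H = putForm-sound (⊖ v) _ h⁻ (putForm-sound v N h H)
      where
      h⁻ : ¬ eval s (⊖ v) ≈ ε
      h⁻ e = h (trans (sym (⁻¹-involutive _)) (trans (⁻¹-cong (trans (sym (eval-⊖ s v)) e)) ε⁻¹≈ε))

    store-sound : {vs : List (Form n)} → All (λ v → ¬ eval s v ≈ ε) vs → Avoid s (store E vs)
    store-sound []       = tt
    store-sound (h ∷ hs) = add-sound _ _ h (store-sound hs)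

    rebuild-sound : ∀ N M → Avoid s N → Avoid s M → Avoid s (rebuild E N M)
    rebuild-sound empty          M _             HM = HM
    rebuild-sound (node _ v l r) M (h , hl , hr) HM =
      rebuild-sound r _ hr (rebuild-sound l _ hl (putForm-sound v M h HM))

    separated-sound : ∀ N (vs : Vec (Form n) m) → Avoid s N → T (separated E N vs) →
      ∀ i j → eval s (lookup vs i) ≈ eval s (lookup vs j) → i ≡ j
    separated-sound N (v ∷ vs) H p i j with T-∧-split (forAll (λ j → known E N (v ⊝ lookup vs j))) p
    separated-sound N (v ∷ vs) H p zero    zero    | _       = λ _ → ≡.refl
    separated-sound N (v ∷ vs) H p (suc i) (suc j) | _  , p′ = cong suc ∘ separated-sound N vs H p′ i j
    separated-sound N (v ∷ vs) H p zero    (suc j) | p₀ , _  =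
      ⊥-elim ∘ known-sound N _ H (forAll-sound _ p₀ j) ∘ zero-⊝ s v (lookup vs j)
    -- Only differences with the smaller index first are tested; the other order follows by symmetry
    -- of `_≈_`.
    separated-sound N (v ∷ vs) H p (suc i) zero    | p₀ , _  =
      ⊥-elim ∘ known-sound N _ H (forAll-sound _ p₀ i) ∘ zero-⊝ s v (lookup vs i) ∘ sym

  -- Permutations of the vector

  symmetric-sound : (E : Lattice n) (N : Store n) (g : List ℕ) → T (symmetric E N g) →
    ∀ s → Vanish s E → Avoid s N → Vanish (unact g s) E × Avoid (unact g s) N
  symmetric-sound E N g p s V H =
    let pr , pN = T-∧-split (all _ (rows E)) p in
      rows-sound E (unact g s) (All.map (λ {v} q → trans (sym (eval-act g s v)) (vanishes-sound E s V (act g v) q))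
                              (all⁺ _ (rows E) pr))
    , everywhere-sound _ N (unact g s) (λ v q → known-sound E s V N (act g v) H q ∘ trans (eval-act g s v)) pN

  -- Makes equality of subset sums decidable and subject to the pigeonhole principle.
  Classified : ℕ → Vec Carrier n → Set ℓ
  Classified {n} m s = ∃ λ (c : Subset n → Fin m) → ∀ S S′ →
    (c S ≡ c S′ → eval s (indicator S) ≈ eval s (indicator S′)) ×
    (eval s (indicator S) ≈ eval s (indicator S′) → c S ≡ c S′)

  -- The sum of the swapped vector over `S` is the sum of the original one over the swapped `S`, so
  -- the subsets are relabelled accordingly.
  classified-swapAt : ∀ k {s : Vec Carrier n} → Classified m s → Classified m (swapAt k s)
  classified-swapAt k {s} (c , h) = c ∘ swapAt k , λ S S′ →
      (λ e → trans (swapped S) (trans (proj₁ (h _ _) e) (sym (swapped S′))))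
    , (λ e → proj₂ (h _ _) (trans (sym (swapped S)) (trans e (swapped S′))))
    where
    swapped : ∀ S → eval (swapAt k s) (indicator S) ≈ eval s (indicator (swapAt k S))
    swapped S = trans (sym (eval-swapAt k s (indicator S)))
                      (reflexive (cong (eval s) (≡.sym (map-swapAt digit k S))))

  classified-unact : ∀ g {s : Vec Carrier n} → Classified m s → Classified m (unact g s)
  classified-unact []       h = h
  classified-unact (k ∷ ks) h = classified-swapAt k (classified-unact ks h)

  equal? : {s : Vec Carrier n} → Classified m s → ∀ S S′ → Dec (eval s (indicator S ⊝ indicator S′) ≈ ε)
  equal? {s = s} (c , h) S S′ = map′
    (zero-⊝ s (indicator S) (indicator S′) ∘ proj₁ (h S S′))
    (proj₂ (h S S′) ∘ ⊝-zero s (indicator S) (indicator S′))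
    (c S Fin.≟ c S′)

  sameSet-swapAt : ∀ k (s : Vec Carrier n) {t : Vec Carrier m} → SameSet (swapAt k s) t → SameSet s t
  sameSet-swapAt k s {t} (f , g) =
      (λ i → let j , e = f (swapIndex k i) in
               j , trans (reflexive (≡.trans (cong (lookup s) (≡.sym (swapIndex-involutive k i)))
                                             (≡.sym (lookup-swapAt k s (swapIndex k i))))) e)
    , (λ j → let i , e = g j in swapIndex k i , trans e (reflexive (lookup-swapAt k s i)))

  sameSet-unact : ∀ g (s : Vec Carrier n) {t : Vec Carrier m} → SameSet (unact g s) t → SameSet s t
  sameSet-unact []       s h = h
  sameSet-unact (k ∷ ks) s {t} h = sameSet-unact ks s {t} (sameSet-swapAt k (unact ks s) {t} h)

  -- Recognising an extremal configuration

  ⟦_⟧ : Term → Vec Carrier 3 → Carrier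
  ⟦ var i ⟧ x = lookup x i
  ⟦ t ⊞ u ⟧ x = ⟦ t ⟧ x ∙ ⟦ u ⟧ x
  ⟦ k ⊡ t ⟧ x = k · ⟦ t ⟧ x
  ⟦ ⊟ t ⟧   x = (⟦ t ⟧ x) ⁻¹

  ⟦_⟧* : Vec Term m → Vec Carrier 3 → Vec Carrier m
  ⟦ es ⟧* x = Vec.map (λ t → ⟦ t ⟧ x) es

  -- A uniform version of the cases of the theorem, so that the six shapes are handled by one
  -- argument; `fits⇒case` and `case⇒shaped` translate.
  record Fits (s : Vec Carrier 6) (sh : Shape) (x : Vec Carrier 3) : Set ℓ where
    constructor fit
    field
      isSet6    : IsSet6 s (⟦ elements sh ⟧* x)
      isRelated : All (λ (t , u) → ⟦ t ⟧ x ≈ ⟦ u ⟧ x) (relations sh)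
      isOrdered : All (λ (t , k) → Ord (⟦ t ⟧ x) (suc k)) (orders sh)

  fits-unact : ∀ g {s sh x} → Fits (unact g s) sh x → Fits s sh x
  fits-unact g {s} {sh} {x} (fit (d , h) r o) = fit (d , sameSet-unact g s {⟦ elements sh ⟧* x} h) r o

  ⟦⟧-eval : (s : Vec Carrier n) (x : Vec Carrier 3) (X : Vec (Form n) 3) →
    (∀ i → lookup x i ≈ eval s (lookup X i)) → ∀ t → ⟦ t ⟧ x ≈ eval s (form X t)
  ⟦⟧-eval s x X h (var i) = h i
  ⟦⟧-eval s x X h (t ⊞ u) =
    trans (∙-cong (⟦⟧-eval s x X h t) (⟦⟧-eval s x X h u)) (sym (eval-⊕ s (form X t) (form X u)))
  ⟦⟧-eval s x X h (k ⊡ t) = trans (·-cong k (⟦⟧-eval s x X h t)) (sym (eval-⊛ s k (form X t)))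
  ⟦⟧-eval s x X h (⊟ t)   = trans (⁻¹-cong (⟦⟧-eval s x X h t)) (sym (eval-⊖ s (form X t)))

  module _ (s : Vec Carrier n) (x : Vec Carrier 3) (X : Vec (Form n) 3)
           (h : ∀ i → lookup x i ≈ eval s (lookup X i)) where

    ⟦⟧*-eval : (es : Vec Term m) → ∀ j → lookup (⟦ es ⟧* x) j ≈ eval s (lookup (Vec.map (form X) es) j)
    ⟦⟧*-eval es j = begin
      lookup (⟦ es ⟧* x) j                   ≡⟨ lookup-map j _ es ⟩
      ⟦ lookup es j ⟧ x                      ≈⟨ ⟦⟧-eval s x X h (lookup es j) ⟩
      eval s (form X (lookup es j))          ≡⟨ cong (eval s) (lookup-map j (form X) es) ⟨
      eval s (lookup (Vec.map (form X) es) j) ∎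

  fits-sound : ∀ sh X E N s → Vanish s E → Avoid s N → T (fits sh X E N) → Fits s sh (Vec.map (eval s) X)
  fits-sound sh X E N s V H p = fit (distinct , covers) relate order
    where
    x = Vec.map (eval s) X
    f = Vec.map (form X) (elements sh)

    h : ∀ i → lookup x i ≈ eval s (lookup X i)
    h i = reflexive (lookup-map i (eval s) X)

    p₁ = T-∧-split (listed E f) p
    p₂ = T-∧-split (separated E N f) (proj₂ p₁)
    p₃ = T-∧-split (related sh X E) (proj₂ p₂)
    left right : Fin 6 → Fin 6 → Bool
    left  i j = vanishes E (unit i ⊝ lookup f j)
    right j i = vanishes E (lookup f j ⊝ unit i)
    p₄ = T-∧-split (forAll (forSome ∘ left)) (proj₁ p₁)

    distinct : Distinct (⟦ elements sh ⟧* x)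
    distinct i j e = separated-sound E s V N f H (proj₁ p₂) i j
      (trans (sym (⟦⟧*-eval s x X h (elements sh) i)) (trans e (⟦⟧*-eval s x X h (elements sh) j)))

    covers : SameSet s (⟦ elements sh ⟧* x)
    covers =
        (λ i → let j , q = forSome-sound (left i) (forAll-sound (forSome ∘ left) (proj₁ p₄) i) in j ,
          trans (sym (eval-unit s i)) (trans (⊝-zero s (unit i) (lookup f j) (vanishes-sound E s V _ q))
                                             (sym (⟦⟧*-eval s x X h (elements sh) j))))
      , (λ j → let i , q = forSome-sound (right j) (forAll-sound (forSome ∘ right) (proj₂ p₄) j) in i ,
          trans (⟦⟧*-eval s x X h (elements sh) j)
                (trans (⊝-zero s (lookup f j) (unit i) (vanishes-sound E s V _ q)) (eval-unit s i)))

    relate : All (λ (t , u) → ⟦ t ⟧ x ≈ ⟦ u ⟧ x) (relations sh)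
    relate = All.map
      (λ { {t , u} q → trans (⟦⟧-eval s x X h t)
             (trans (⊝-zero s (form X t) (form X u) (vanishes-sound E s V _ q)) (sym (⟦⟧-eval s x X h u))) })
      (all⁺ _ (relations sh) (proj₁ p₃))

    multiple : ∀ k t → k · ⟦ t ⟧ x ≈ eval s (k ⊛ form X t)
    multiple k t = trans (·-cong k (⟦⟧-eval s x X h t)) (sym (eval-⊛ s k (form X t)))

    order₁ : ∀ t k → T (vanishes E (suc k ⊛ form X t)
                        ∧ forAll {n = k} (λ i → known E N (suc (toℕ i) ⊛ form X t))) → Ord (⟦ t ⟧ x) (suc k)
    order₁ t k q = s≤s z≤n , trans (multiple (suc k) t) (vanishes-sound E s V _ (proj₁ q′)) , minimal
      where
      q′ = T-∧-split (vanishes E (suc k ⊛ form X t)) q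
      minimal : ∀ j → 1 ℕ.≤ j → j ℕ.< suc k → ¬ j · ⟦ t ⟧ x ≈ ε
      minimal (suc j) _ (s≤s j<k) e = known-sound E s V N _ H
        (subst (λ i → T (known E N (suc i ⊛ form X t))) (toℕ-fromℕ< j<k)
               (forAll-sound (λ i → known E N (suc (toℕ i) ⊛ form X t)) (proj₂ q′) (fromℕ< j<k)))
        (trans (sym (multiple (suc j) t)) e)

    order : All (λ (t , k) → Ord (⟦ t ⟧ x) (suc k)) (orders sh)
    order = All.map (λ { {t , k} q → order₁ t k q }) (all⁺ _ (orders sh) (proj₂ p₃))

  -- Soundness of the certificate check

  Shaped : Vec Carrier 6 → Set (c ⊔ ℓ)
  Shaped s = ∃ λ sh → ∃ λ x → Fits s sh x

  shaped-unact : ∀ g {s} → Shaped (unact g s) → Shaped s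
  shaped-unact g (sh , x , F) = sh , x , fits-unact g F

  -- `P` is an invariant of the queue, preserved by the generators. Each queued form is decided at
  -- `s`; one that vanishes settles the goal `Q` at once, so only nonvanishing forms enter the
  -- store.
  close-sound : ∀ {p} (P : Form n → Set p) {q} {Q : Set q} (E : Lattice n) (s : Vec Carrier n) → Vanish s E →
    (∀ v → P v → Q ⊎ ¬ eval s v ≈ ε) → ∀ gs → All (λ g → ∀ v → P v → P (act g v)) gs →
    ∀ f vs N → All P vs → Avoid s N → Q ⊎ Avoid s (close f gs E vs N)
  close-sound P E s V d gs cl zero    vs       N hs       H = inj₂ H
  close-sound P E s V d gs cl (suc f) []       N hs       H = inj₂ H
  close-sound P E s V d gs cl (suc f) (v ∷ vs) N (h ∷ hs) H with known E N v
  ... | true  = close-sound P E s V d gs cl f vs N hs H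
  ... | false with d v h
  ...   | inj₁ q  = inj₁ q
  ...   | inj₂ v≉ε = close-sound P E s V d gs cl f _ _
                       (All.++⁺ (All.map⁺ (All.map (λ a → a v h) cl)) hs) (add-sound E s V v N v≉ε H)

  check-sound : ∀ t E N → T (check t E N) → ∀ s → Classified 20 s → Vanish s E → Avoid s N → Shaped s
  check-sound (leaf sh X) E N p s C V H =
    sh , _ , fits-sound sh (Vec.map (indicator ∘ decode 6) X) E N s V H p
  check-sound (clique Ss) E N p s (c , h) V H
    -- The 21 subsets fall into 20 classes, 19 for Σ(S) and one for 0; `≤-refl` is read as 20 < 21.
    with i , j , i<j , e ← pigeonhole ≤-refl (λ i → c (decode 6 (lookup Ss i)))
    = ⊥-elim (Fin.<-irrefl (separated-sound E s V N forms H p i j sums≈) i<j)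
    where
    forms = Vec.map (indicator ∘ decode 6) Ss
    sums≈ : eval s (lookup forms i) ≈ eval s (lookup forms j)
    sums≈ = trans (reflexive (cong (eval s) (lookup-map i _ Ss)))
              (trans (proj₁ (h _ _) e) (reflexive (cong (eval s) (≡.sym (lookup-map j _ Ss)))))
  check-sound (split S S′ gs t t′) E N p s C V H =
    [ (λ F → F) , (λ H′ → check-sound t′ E _ (proj₂ p₂) s C V H′) ]′
      (close-sound P E s V decide gs (All.map (λ {g} → transport g) (all⁺ _ gs (proj₁ p₂))) 1000 (d ∷ []) N
        (base ∷ []) H)
    where
    d = indicator (decode 6 S) ⊝ indicator (decode 6 S′)
    E′ = insert 1000 d E
    p₁ = T-∧-split (checkEqual t E′ N) p
    p₂ = T-∧-split (all (symmetric E N) gs) (proj₂ p₁)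

    -- All `s` are quantified over because `act g v` at `s` is `v` at `unact g s`. Decidability
    -- belongs to `P` because an image is available only as a form, not as a pair of subsets.
    P : Form 6 → Set (c ⊔ ℓ)
    P v = ∀ s → Classified 20 s → Dec (eval s v ≈ ε) × (Vanish s E → Avoid s N → eval s v ≈ ε → Shaped s)

    base : P d
    base s C = equal? {s = s} C (decode 6 S) (decode 6 S′) , λ V H e →
      let V′ = insert-sound 1000 d E s e V in
      check-sound t E′ _ (proj₁ p₁) s C V′ (rebuild-sound E′ s V′ N empty H tt)

    transport : ∀ g → T (symmetric E N g) → ∀ v → P v → P (act g v)
    transport g q v h s C =
      -- The vanishing case is treated at the permuted vector, which satisfies `E` and `N` by the
      -- tested symmetry; a shape found there is a shape of `s`, both listing the same set.
      let dec , refute = h (unact g s) (classified-unact g C) in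
        map′ (trans (eval-act g s v)) (trans (sym (eval-act g s v))) dec
      , λ V H e → let V′ , H′ = symmetric-sound E N g q s V H in
                  shaped-unact g (refute V′ H′ (trans (sym (eval-act g s v)) e))

    decide : ∀ v → P v → Shaped s ⊎ ¬ eval s v ≈ ε
    decide v h with h s C
    ... | yes e , refute = inj₁ (refute V H e)
    ... | no ¬e , _      = inj₂ ¬e

  -- From the size of Σ(S) to classes of subsets

  sumOver-unoccupied : (S : Subset n) (s : Vec Carrier n) → ¬ T (occupied S) → sumOver S s ≈ ε
  sumOver-unoccupied []            []      _ = refl
  sumOver-unoccupied (inside ∷ S)  (x ∷ s) h = ⊥-elim (h _)
  sumOver-unoccupied (outside ∷ S) (x ∷ s) h = sumOver-unoccupied S s h

  occupied⇒nonzero : {s : Vec Carrier n} → ZeroSumFree s → ∀ S → T (occupied S) → ¬ sumOver S s ≈ ε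
  occupied⇒nonzero zsf S o e = zsf (S , occupied⇒nonempty S o , sym e)

  -- Class `zero` is reserved for the sum 0, which by zero-sum freeness only the empty subset
  -- attains; the other classes are the indices of the enumeration `f`, shifted by one.
  classify : {s : Vec Carrier n} → ZeroSumFree s → HasSize (InΣ s) m → Classified (suc m) s
  classify {n} {m} {s} zsf (f , f-inj , _ , cover) = class , λ S S′ →
      (λ e → trans (eval-indicator s S) (trans (proj₁ (reflects S S′) e) (sym (eval-indicator s S′))))
    , (λ e → proj₂ (reflects S S′) (trans (sym (eval-indicator s S)) (trans e (eval-indicator s S′))))
    where
    index : ∀ S → T (occupied S) → ∃ λ i → sumOver S s ≈ f i
    index S o = cover (sumOver S s) (S , occupied⇒nonempty S o , refl)

    -- The decision is an argument, so that the `with` in `reflects` makes `class` compute on both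
    -- subsets.
    class′ : ∀ S → Dec (T (occupied S)) → Fin (suc m)
    class′ S (yes o) = suc (proj₁ (index S o))
    class′ S (no _)  = zero

    class : Subset n → Fin (suc m)
    class S = class′ S (T? (occupied S))

    reflects : ∀ S S′ → (class S ≡ class S′ → sumOver S s ≈ sumOver S′ s) ×
                        (sumOver S s ≈ sumOver S′ s → class S ≡ class S′)
    reflects S S′ with T? (occupied S) | T? (occupied S′)
    ... | yes o | yes o′ =
      let i , e = index S o ; j , e′ = index S′ o′ in
        (λ i≡j → trans e (trans (reflexive (cong f (suc-injective i≡j))) (sym e′)))
      , (λ h → cong suc (f-inj i j (trans (sym e) (trans h e′))))
    ... | yes o | no ¬o′ =
        (λ ())
      , (λ h → ⊥-elim (occupied⇒nonzero zsf S o (trans h (sumOver-unoccupied S′ s ¬o′))))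
    ... | no ¬o | yes o′ =
        (λ ())
      , (λ h → ⊥-elim (occupied⇒nonzero zsf S′ o′ (trans (sym h) (sumOver-unoccupied S s ¬o))))
    ... | no ¬o | no ¬o′ =
        (λ _ → trans (sumOver-unoccupied S s ¬o) (sym (sumOver-unoccupied S′ s ¬o′)))
      , (λ _ → ≡.refl)

  initial-sound : (s : Vec Carrier n) → Distinct s → ZeroSumFree s → Avoid s (initial n)
  initial-sound {n} s distinct zsf = store-sound (trivial n) s (vanish-trivial s) (All.++⁺
    (All.map⁺ (All.map (λ {S} o e → occupied⇒nonzero zsf S o (trans (sym (eval-indicator s S)) e))
                       (all-filter (T? ∘ occupied) (subsets n))))
    (All.map⁺ (All.map (λ { {i , j} i≢j e → i≢j (distinct i j
                              (trans (sym (eval-unit s i)) (trans (⊝-zero s (unit i) (unit j) e) (eval-unit s j)))) })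
                       (all-filter (λ (i , j) → ¬? (i Fin.≟ j))
                                   (List.cartesianProduct (List.allFin n) (List.allFin n))))))

  -- Translation between shapes and the cases of the theorem

  fits⇒case : ∀ {s} sh x → Fits s sh x → OneOfCases s
  fits⇒case caseI₀  (x ∷ y ∷ z ∷ []) (fit h (r ∷ []) (o ∷ [])) = x , y , z , inj₁ (h , o , 0 , inj₁ r)
  fits⇒case caseI₁  (x ∷ y ∷ z ∷ []) (fit h (r ∷ []) (o ∷ [])) = x , y , z , inj₁ (h , o , 1 , inj₁ r)
  fits⇒case caseII  (x ∷ y ∷ z ∷ []) (fit h [] (o ∷ [])) = x , y , z , inj₂ (inj₁ (h , o))
  fits⇒case caseIII (x ∷ y ∷ z ∷ []) (fit h [] (o ∷ [])) = x , y , z , inj₂ (inj₂ (inj₁ (h , o)))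
  fits⇒case caseIV  (x ∷ y ∷ z ∷ []) (fit h [] (o ∷ [])) = x , y , z , inj₂ (inj₂ (inj₂ (inj₁ (h , o))))
  fits⇒case caseV   (x ∷ y ∷ z ∷ []) (fit h (r ∷ []) (o ∷ o′ ∷ [])) =
    x , y , z , inj₂ (inj₂ (inj₂ (inj₂ (h , r , o , o′))))

  -- For an involution, ⟨x⟩ = {0, x}. Together with -x = x, used below for negative multiples, this
  -- divides case (i) into `caseI₀` and `caseI₁`.
  multiples-of-involution : ∀ {x} → 2 · x ≈ ε → ∀ k → k · x ≈ 0 · x ⊎ k · x ≈ 1 · x
  multiples-of-involution h zero    = inj₁ refl
  multiples-of-involution h (suc k) with multiples-of-involution h k
  ... | inj₁ e = inj₂ (∙-congˡ e)
  ... | inj₂ e = inj₁ (trans (∙-congˡ e) h)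

  inCyclic-involution : ∀ {x y} → 2 · x ≈ ε → InCyclic y x → y ≈ 0 · x ⊎ y ≈ 1 · x
  inCyclic-involution h (k , inj₁ e) with multiples-of-involution h k
  ... | inj₁ e′ = inj₁ (trans e e′)
  ... | inj₂ e′ = inj₂ (trans e e′)
  inCyclic-involution {x} h (k , inj₂ e) with multiples-of-involution h k
  ... | inj₁ e′ = inj₁ (trans e (trans (⁻¹-cong e′) ε⁻¹≈ε))
  ... | inj₂ e′ = inj₂ (trans e (trans (⁻¹-cong (trans e′ (identityʳ x))) (sym (inverseʳ-unique x (1 · x) h))))

  case⇒shaped : ∀ {s} → OneOfCases s → Shaped s
  case⇒shaped (x , y , z , inj₁ (h , o , r)) with inCyclic-involution (proj₁ (proj₂ o)) r
  ... | inj₁ r₀ = caseI₀ , x ∷ y ∷ z ∷ [] , fit h (r₀ ∷ []) (o ∷ [])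
  ... | inj₂ r₁ = caseI₁ , x ∷ y ∷ z ∷ [] , fit h (r₁ ∷ []) (o ∷ [])
  case⇒shaped (x , y , z , inj₂ (inj₁ (h , o))) = caseII , x ∷ y ∷ z ∷ [] , fit h [] (o ∷ [])
  case⇒shaped (x , y , z , inj₂ (inj₂ (inj₁ (h , o)))) = caseIII , x ∷ y ∷ z ∷ [] , fit h [] (o ∷ [])
  case⇒shaped (x , y , z , inj₂ (inj₂ (inj₂ (inj₁ (h , o))))) = caseIV , x ∷ y ∷ z ∷ [] , fit h [] (o ∷ [])
  case⇒shaped (x , y , z , inj₂ (inj₂ (inj₂ (inj₂ (h , r , o , o′))))) =
    caseV , x ∷ y ∷ z ∷ [] , fit h (r ∷ []) (o ∷ o′ ∷ [])

  -- Σ depends only on the set, not on its listing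

  open CommutativeMonoidSum commutativeMonoid using (sum; sum-permute; sum-cong-≋)

  -- Padding with `ε` turns a subset sum into a sum over all indices, to which `sum-permute`
  -- applies.
  restrict : Subset n → Vec Carrier n → Fin n → Carrier
  restrict S s i = if lookup S i then lookup s i else ε

  sumOver≈sum : (S : Subset n) (s : Vec Carrier n) → sumOver S s ≈ sum (restrict S s)
  sumOver≈sum []            []      = refl
  sumOver≈sum (inside ∷ S)  (x ∷ s) = ∙-congˡ (sumOver≈sum S s)
  sumOver≈sum (outside ∷ S) (x ∷ s) = trans (sumOver≈sum S s) (sym (identityˡ _))

  -- Without repetitions the two index maps of `SameSet` are mutually inverse, so the listings
  -- differ by a permutation, along which the subset is pulled back.
  inΣ-sameSet : {s : Vec Carrier n} {t : Vec Carrier m} → Distinct s → Distinct t → SameSet s t →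
    ∀ y → InΣ t y → InΣ s y
  inΣ-sameSet {n} {m} {s} {t} ds dt (f , g) y (S , (j , j∈S) , e) = S′ , (τ j , τj∈S′) , (begin
      y                                    ≈⟨ e ⟩
      sumOver S t                          ≈⟨ sumOver≈sum S t ⟩
      sum (restrict S t)                   ≈⟨ sum-permute (restrict S t) π ⟩
      sum (restrict S t ∘ σ)               ≈⟨ sum-cong-≋ pointwise ⟨
      sum (restrict S′ s)                  ≈⟨ sumOver≈sum S′ s ⟨
      sumOver S′ s                         ∎)
    where
    σ : Fin n → Fin m
    σ i = proj₁ (f i)

    τ : Fin m → Fin n
    τ j = proj₁ (g j)

    στ : ∀ j → σ (τ j) ≡ j
    στ j = dt _ _ (sym (trans (proj₂ (g j)) (proj₂ (f (τ j)))))

    π : Permutation n m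
    π = permutation σ τ στ (λ i → ds _ _ (sym (trans (proj₂ (f i)) (proj₂ (g (σ i))))))

    S′ : Subset n
    S′ = tabulate (lookup S ∘ σ)

    τj∈S′ : τ j ∈ S′
    τj∈S′ = lookup⇒[]= (τ j) S′ (≡.trans (lookup∘tabulate (lookup S ∘ σ) (τ j))
                                  (≡.trans (cong (lookup S) (στ j)) ([]=⇒lookup j∈S)))

    pointwise : ∀ i → restrict S′ s i ≈ restrict S t (σ i)
    pointwise i rewrite lookup∘tabulate (lookup S ∘ σ) i with lookup S (σ i)
    ... | inside  = proj₂ (f i)
    ... | outside = refl

  -- The number of subset sums of a configuration

  module _ (es : Vec Term m) (rels : List (Term × Term)) (ords : List (Term × ℕ)) (reps : Vec ℕ n) where
    open Sizes es rels ords reps hiding (sized)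

    -- The relations hold at `x`, so congruent forms in ℤ³ have equal values; zero-sum freeness
    -- makes `x` avoid all of `nonzero`. Hence the representatives have distinct values and exhaust
    -- the sums.
    sized-sound : Sizes.sized es rels ords reps ≡ true → ∀ x → All (λ (t , u) → ⟦ t ⟧ x ≈ ⟦ u ⟧ x) rels →
      All (λ (t , k) → Ord (⟦ t ⟧ x) (suc k)) ords → ZeroSumFree (⟦ es ⟧* x) → HasSize (InΣ (⟦ es ⟧* x)) n
    sized-sound checked x rs os zsf =
        f
      , (λ i j e → separated-sound basis x V nonzero (tabulate (sums ∘ representative)) H (proj₁ p₁) i j
           (trans (tabulated i) (trans e (sym (tabulated j)))))
      , (λ i → representative i , occupied⇒nonempty _ (forAll-sound (occupied ∘ representative) (proj₁ p₂) i) , refl)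
      , covered
      where
      f : Fin n → Carrier
      f i = sumOver (representative i) (⟦ es ⟧* x)

      p₁ = T-∧-split (separated basis nonzero (tabulate (sums ∘ representative))) (from-true checked)
      p₂ = T-∧-split (forAll (occupied ∘ representative)) (proj₂ p₁)

      unit-eval : ∀ i → lookup x i ≈ eval x (lookup units i)
      unit-eval i = sym (trans (reflexive (cong (eval x) (lookup∘tabulate unit i))) (eval-unit x i))

      term : ∀ t → ⟦ t ⟧ x ≈ eval x (form units t)
      term = ⟦⟧-eval x x units unit-eval

      sums-eval : ∀ S → eval x (sums S) ≈ sumOver S (⟦ es ⟧* x)
      sums-eval = eval-subsum x (⟦ es ⟧* x) forms (⟦⟧*-eval x x units unit-eval es)

      tabulated : ∀ i → eval x (lookup (tabulate (sums ∘ representative)) i) ≈ f i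
      tabulated i = trans (reflexive (cong (eval x) (lookup∘tabulate (sums ∘ representative) i)))
                          (sums-eval (representative i))

      V : Vanish x basis
      V = span-sound x (All.++⁺
        (All.map⁺ (All.map (λ { {t , u} r → zero-⊝ x (form units t) (form units u)
                                  (trans (sym (term t)) (trans r (term u))) }) rs))
        (All.map⁺ (All.map (λ { {t , k} (_ , o , _) →
                                  trans (eval-⊛ x (suc k) (form units t)) (trans (·-cong (suc k) (sym (term t))) o) }) os)))

      H : Avoid x nonzero
      H = store-sound basis x V (All.map⁺ (All.map
        (λ {S} o e → occupied⇒nonzero zsf S o (trans (sym (sums-eval S)) e))
        (all-filter (T? ∘ occupied) (subsets m))))

      covered : ∀ y → InΣ (⟦ es ⟧* x) y → ∃ λ i → y ≈ f i
      covered y (S , S≢∅ , e) =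
        let i , q = forSome-sound (λ i → vanishes basis (sums S ⊝ sums (representative i)))
                      (All.lookup (all⁺ represented (occupiedSubsets m) (proj₂ p₂))
                      (∈-filter⁺ (T? ∘ occupied) (∈-subsets S) (nonempty⇒occupied S S≢∅)))
        in i , trans e (trans (sym (sums-eval S))
                 (trans (⊝-zero x (sums S) (sums (representative i)) (vanishes-sound basis x V _ q))
                        (sums-eval (representative i))))

  hasSize-cong : {P Q : Carrier → Set ℓ} → (∀ y → P y → Q y) → (∀ y → Q y → P y) → HasSize P m → HasSize Q m
  hasSize-cong P⊆Q Q⊆P (f , f-injective , f∈ , cover) =
    f , f-injective , (λ i → P⊆Q (f i) (f∈ i)) , (λ y → cover y ∘ Q⊆P y)

  -- The two implications, relative to the computations

  extremal⇒case : ∀ t → check t (trivial 6) (initial 6) ≡ true →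
    ∀ s → Distinct s → ZeroSumFree s → HasSize (InΣ s) 19 → OneOfCases s
  extremal⇒case t checked s distinct zsf size =
    let sh , x , F = check-sound t (trivial 6) (initial 6) (from-true {check t (trivial 6) (initial 6)} checked) s
                       (classify {s = s} zsf size) (vanish-trivial {6} s) (initial-sound {6} s distinct zsf)
    in fits⇒case {s} sh x F

  fits⇒extremal : ∀ s sh x → Sized sh → Distinct s → ZeroSumFree s → Fits s sh x → HasSize (InΣ s) 19
  fits⇒extremal s sh x checked distinct zsf (fit (distinct′ , same) rs os) =
    hasSize-cong t⊆s s⊆t (sized-sound {6} {19} (elements sh) (relations sh) (orders sh) (representatives sh)
      checked x rs os (zsf ∘ t⊆s ε))
    where
    t⊆s : ∀ y → InΣ (⟦ elements sh ⟧* x) y → InΣ s y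
    t⊆s = inΣ-sameSet {s = s} {t = ⟦ elements sh ⟧* x} distinct distinct′ same

    s⊆t : ∀ y → InΣ s y → InΣ (⟦ elements sh ⟧* x) y
    s⊆t = inΣ-sameSet {s = ⟦ elements sh ⟧* x} {t = s} distinct′ distinct (proj₂ same , proj₁ same)

  case⇒extremal : (∀ sh → Sized sh) → ∀ s → Distinct s → ZeroSumFree s → OneOfCases s → HasSize (InΣ s) 19
  case⇒extremal checked s distinct zsf h =
    let sh , x , F = case⇒shaped {s = s} h in fits⇒extremal s sh x (checked sh) distinct zsf F

sizes-checked : ∀ sh → Sized sh
sizes-checked caseI₀  = ≡.refl
sizes-checked caseI₁  = ≡.refl
sizes-checked caseII  = ≡.refl
sizes-checked caseIII = ≡.refl
sizes-checked caseIV  = ≡.refl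
sizes-checked caseV   = ≡.refl

-- Let s₀, ..., s₅ be the elements of S. In every leaf the codes are powers of two, that is, x₁, x₂,
-- x₃ are single elements; a variable absent from the shape has the placeholder 1.
certificate : Tree
certificate =
  -- The split asks whether s₀ + s₁ = s₂. The two words, of cycle types (2)(3) and (2)(2), generate
  -- all permutations of the six positions.
  split 3 4 ((2 ∷ 1 ∷ 3 ∷ 2 ∷ 4 ∷ []) ∷ (0 ∷ 3 ∷ []) ∷ [])
   -- Given s₀ + s₁ = s₂, the equation s₁ + s₄ + s₅ = s₂ means s₄ + s₅ = s₀.
   (split 50 4 ((0 ∷ 3 ∷ 4 ∷ []) ∷ [])
   (split 2 29 ((4 ∷ []) ∷ [])
   (split 7 24 []
   (split 36 16 []
   (split 46 1 []
   (leaf caseIII (32 ∷ 1 ∷ 1 ∷ []))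
   (split 10 1 []
   (leaf caseIV (4 ∷ 1 ∷ 1 ∷ []))
   (clique (0 ∷ 32 ∷ 16 ∷ 48 ∷ 8 ∷ 40 ∷ 24 ∷ 56 ∷ 52 ∷ 12 ∷ 28 ∷ 60 ∷ 2 ∷ 34 ∷ 10 ∷ 42 ∷ 26 ∷ 62 ∷ 17 ∷ 25 ∷ 57 ∷ []))))
   (split 17 12 []
   (clique (0 ∷ 32 ∷ 16 ∷ 48 ∷ 8 ∷ 40 ∷ 24 ∷ 56 ∷ 4 ∷ 36 ∷ 52 ∷ 12 ∷ 44 ∷ 60 ∷ 2 ∷ 34 ∷ 62 ∷ 25 ∷ 57 ∷ 37 ∷ 53 ∷ []))
   (clique (0 ∷ 16 ∷ 48 ∷ 8 ∷ 24 ∷ 56 ∷ 4 ∷ 36 ∷ 52 ∷ 12 ∷ 28 ∷ 60 ∷ 2 ∷ 34 ∷ 6 ∷ 17 ∷ 25 ∷ 57 ∷ 21 ∷ 53 ∷ 63 ∷ []))))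
   (split 35 8 []
   (split 1 14 []
   (clique (0 ∷ 32 ∷ 48 ∷ 8 ∷ 24 ∷ 56 ∷ 4 ∷ 12 ∷ 28 ∷ 60 ∷ 2 ∷ 34 ∷ 10 ∷ 26 ∷ 6 ∷ 46 ∷ 30 ∷ 62 ∷ 25 ∷ 57 ∷ 31 ∷ []))
   (split 38 16 []
   (split 19 32 []
   (leaf caseV (4 ∷ 16 ∷ 1 ∷ []))
   (clique (0 ∷ 32 ∷ 16 ∷ 48 ∷ 8 ∷ 40 ∷ 24 ∷ 56 ∷ 4 ∷ 12 ∷ 44 ∷ 28 ∷ 60 ∷ 2 ∷ 34 ∷ 62 ∷ 33 ∷ 25 ∷ 57 ∷ 45 ∷ 63 ∷ [])))
   (split 32 6 []
   (clique (0 ∷ 32 ∷ 48 ∷ 8 ∷ 40 ∷ 24 ∷ 56 ∷ 4 ∷ 20 ∷ 12 ∷ 28 ∷ 60 ∷ 2 ∷ 34 ∷ 18 ∷ 10 ∷ 26 ∷ 62 ∷ 49 ∷ 25 ∷ 57 ∷ []))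
   (clique (0 ∷ 32 ∷ 16 ∷ 48 ∷ 8 ∷ 24 ∷ 56 ∷ 4 ∷ 12 ∷ 28 ∷ 60 ∷ 2 ∷ 34 ∷ 10 ∷ 26 ∷ 6 ∷ 62 ∷ 49 ∷ 25 ∷ 57 ∷ 63 ∷ [])))))
   (split 16 36 []
   (split 6 8 []
   (split 36 10 []
   (leaf caseIV (16 ∷ 1 ∷ 1 ∷ []))
   (clique (0 ∷ 32 ∷ 16 ∷ 48 ∷ 8 ∷ 40 ∷ 24 ∷ 56 ∷ 4 ∷ 20 ∷ 52 ∷ 12 ∷ 28 ∷ 60 ∷ 2 ∷ 34 ∷ 42 ∷ 17 ∷ 25 ∷ 57 ∷ 21 ∷ [])))
   (split 6 32 []
   (split 10 36 []
   (leaf caseIII (32 ∷ 1 ∷ 1 ∷ []))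
   (clique (0 ∷ 32 ∷ 16 ∷ 48 ∷ 24 ∷ 56 ∷ 4 ∷ 20 ∷ 52 ∷ 12 ∷ 28 ∷ 60 ∷ 2 ∷ 34 ∷ 18 ∷ 26 ∷ 54 ∷ 62 ∷ 25 ∷ 57 ∷ 63 ∷ [])))
   (clique (0 ∷ 32 ∷ 16 ∷ 48 ∷ 24 ∷ 56 ∷ 4 ∷ 20 ∷ 52 ∷ 12 ∷ 28 ∷ 60 ∷ 2 ∷ 34 ∷ 18 ∷ 6 ∷ 54 ∷ 62 ∷ 25 ∷ 57 ∷ 63 ∷ []))))
   (split 16 38 []
   (split 27 32 []
   (clique (0 ∷ 32 ∷ 16 ∷ 48 ∷ 24 ∷ 4 ∷ 36 ∷ 20 ∷ 52 ∷ 12 ∷ 60 ∷ 2 ∷ 34 ∷ 18 ∷ 26 ∷ 6 ∷ 54 ∷ 14 ∷ 62 ∷ 17 ∷ 25 ∷ []))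
   (clique (0 ∷ 32 ∷ 16 ∷ 48 ∷ 24 ∷ 56 ∷ 4 ∷ 36 ∷ 52 ∷ 12 ∷ 44 ∷ 28 ∷ 60 ∷ 2 ∷ 34 ∷ 62 ∷ 17 ∷ 25 ∷ 57 ∷ 45 ∷ 63 ∷ [])))
   (split 39 16 []
   (split 27 32 []
   (clique (0 ∷ 32 ∷ 16 ∷ 48 ∷ 24 ∷ 4 ∷ 36 ∷ 20 ∷ 52 ∷ 12 ∷ 60 ∷ 2 ∷ 34 ∷ 18 ∷ 26 ∷ 6 ∷ 38 ∷ 54 ∷ 62 ∷ 25 ∷ 63 ∷ []))
   (clique (0 ∷ 32 ∷ 16 ∷ 48 ∷ 24 ∷ 56 ∷ 4 ∷ 36 ∷ 52 ∷ 12 ∷ 44 ∷ 28 ∷ 60 ∷ 2 ∷ 34 ∷ 38 ∷ 62 ∷ 25 ∷ 57 ∷ 45 ∷ 63 ∷ [])))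
   (split 38 24 []
   (clique (0 ∷ 16 ∷ 48 ∷ 8 ∷ 24 ∷ 56 ∷ 4 ∷ 36 ∷ 52 ∷ 12 ∷ 28 ∷ 60 ∷ 2 ∷ 34 ∷ 6 ∷ 54 ∷ 62 ∷ 25 ∷ 57 ∷ 55 ∷ 63 ∷ []))
   (clique (0 ∷ 16 ∷ 48 ∷ 4 ∷ 36 ∷ 20 ∷ 52 ∷ 60 ∷ 2 ∷ 34 ∷ 6 ∷ 38 ∷ 54 ∷ 17 ∷ 49 ∷ 25 ∷ 21 ∷ 53 ∷ 39 ∷ 55 ∷ 63 ∷ []))))))))
   (split 2 61 []
   (split 32 6 ((4 ∷ []) ∷ [])
   (split 26 32 []
   (split 45 16 []
   (leaf caseIV (4 ∷ 1 ∷ 1 ∷ []))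
   (clique (0 ∷ 32 ∷ 48 ∷ 8 ∷ 40 ∷ 24 ∷ 56 ∷ 52 ∷ 12 ∷ 44 ∷ 28 ∷ 60 ∷ 2 ∷ 18 ∷ 10 ∷ 62 ∷ 57 ∷ 53 ∷ 45 ∷ 29 ∷ 63 ∷ [])))
   (split 24 32 []
   (split 10 48 []
   (leaf caseIV (1 ∷ 1 ∷ 1 ∷ []))
   (clique (0 ∷ 32 ∷ 16 ∷ 48 ∷ 8 ∷ 56 ∷ 4 ∷ 36 ∷ 20 ∷ 52 ∷ 12 ∷ 60 ∷ 2 ∷ 34 ∷ 18 ∷ 54 ∷ 62 ∷ 49 ∷ 57 ∷ 37 ∷ 53 ∷ [])))
   (split 12 49 []
   (clique (0 ∷ 32 ∷ 48 ∷ 8 ∷ 40 ∷ 56 ∷ 4 ∷ 36 ∷ 12 ∷ 44 ∷ 60 ∷ 2 ∷ 34 ∷ 18 ∷ 42 ∷ 46 ∷ 62 ∷ 57 ∷ 45 ∷ 29 ∷ 63 ∷ []))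
   (clique (0 ∷ 32 ∷ 48 ∷ 40 ∷ 56 ∷ 4 ∷ 36 ∷ 52 ∷ 12 ∷ 44 ∷ 28 ∷ 60 ∷ 2 ∷ 34 ∷ 18 ∷ 54 ∷ 62 ∷ 57 ∷ 45 ∷ 29 ∷ 63 ∷ [])))))
   (split 24 4 ((4 ∷ []) ∷ [])
   (split 18 32 []
   (clique (0 ∷ 32 ∷ 48 ∷ 8 ∷ 40 ∷ 24 ∷ 56 ∷ 20 ∷ 52 ∷ 12 ∷ 44 ∷ 28 ∷ 60 ∷ 2 ∷ 10 ∷ 62 ∷ 57 ∷ 53 ∷ 45 ∷ 29 ∷ 63 ∷ []))
   (split 18 45 []
   (clique (0 ∷ 32 ∷ 16 ∷ 48 ∷ 8 ∷ 40 ∷ 24 ∷ 56 ∷ 12 ∷ 44 ∷ 28 ∷ 60 ∷ 2 ∷ 18 ∷ 10 ∷ 26 ∷ 46 ∷ 62 ∷ 41 ∷ 57 ∷ 47 ∷ []))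
   (clique (0 ∷ 32 ∷ 48 ∷ 8 ∷ 24 ∷ 56 ∷ 52 ∷ 12 ∷ 28 ∷ 60 ∷ 2 ∷ 18 ∷ 10 ∷ 26 ∷ 33 ∷ 49 ∷ 57 ∷ 53 ∷ 45 ∷ 29 ∷ 63 ∷ []))))
   (split 24 6 ((4 ∷ []) ∷ [])
   (clique (0 ∷ 16 ∷ 8 ∷ 24 ∷ 56 ∷ 4 ∷ 36 ∷ 52 ∷ 12 ∷ 28 ∷ 60 ∷ 2 ∷ 34 ∷ 18 ∷ 26 ∷ 54 ∷ 57 ∷ 37 ∷ 53 ∷ 29 ∷ 55 ∷ []))
   (split 8 6 []
   (split 1 26 ((4 ∷ []) ∷ [])
   (clique (0 ∷ 32 ∷ 48 ∷ 8 ∷ 40 ∷ 56 ∷ 4 ∷ 36 ∷ 52 ∷ 12 ∷ 44 ∷ 60 ∷ 2 ∷ 34 ∷ 42 ∷ 62 ∷ 41 ∷ 57 ∷ 53 ∷ 45 ∷ 47 ∷ []))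
   (clique (0 ∷ 32 ∷ 48 ∷ 8 ∷ 40 ∷ 56 ∷ 4 ∷ 36 ∷ 52 ∷ 12 ∷ 44 ∷ 60 ∷ 2 ∷ 34 ∷ 42 ∷ 41 ∷ 57 ∷ 37 ∷ 53 ∷ 45 ∷ 47 ∷ [])))
   (clique (0 ∷ 32 ∷ 48 ∷ 56 ∷ 4 ∷ 36 ∷ 52 ∷ 12 ∷ 44 ∷ 60 ∷ 2 ∷ 34 ∷ 6 ∷ 38 ∷ 54 ∷ 62 ∷ 41 ∷ 57 ∷ 45 ∷ 47 ∷ 63 ∷ []))))))
   (split 51 8 []
   (split 37 2 ((4 ∷ []) ∷ [])
   (split 27 32 []
   (split 1 38 []
   (leaf caseV (1 ∷ 2 ∷ 1 ∷ []))
   (clique (0 ∷ 32 ∷ 48 ∷ 8 ∷ 40 ∷ 24 ∷ 56 ∷ 4 ∷ 36 ∷ 20 ∷ 12 ∷ 44 ∷ 60 ∷ 34 ∷ 10 ∷ 42 ∷ 26 ∷ 38 ∷ 14 ∷ 62 ∷ 33 ∷ [])))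
   (split 30 32 []
   (split 20 42 []
   (leaf caseIII (1 ∷ 1 ∷ 1 ∷ []))
   (clique (0 ∷ 32 ∷ 48 ∷ 8 ∷ 40 ∷ 56 ∷ 4 ∷ 36 ∷ 20 ∷ 12 ∷ 44 ∷ 28 ∷ 60 ∷ 34 ∷ 10 ∷ 42 ∷ 26 ∷ 14 ∷ 62 ∷ 33 ∷ 29 ∷ [])))
   (clique (0 ∷ 32 ∷ 48 ∷ 8 ∷ 40 ∷ 56 ∷ 4 ∷ 36 ∷ 20 ∷ 12 ∷ 44 ∷ 28 ∷ 60 ∷ 10 ∷ 26 ∷ 14 ∷ 30 ∷ 62 ∷ 33 ∷ 49 ∷ 63 ∷ []))))
   (split 1 30 ((4 ∷ []) ∷ [])
   (split 9 2 []
   (clique (0 ∷ 32 ∷ 48 ∷ 8 ∷ 40 ∷ 24 ∷ 56 ∷ 4 ∷ 36 ∷ 20 ∷ 12 ∷ 28 ∷ 60 ∷ 34 ∷ 18 ∷ 10 ∷ 26 ∷ 22 ∷ 62 ∷ 49 ∷ 63 ∷ []))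
   (split 1 38 []
   (clique (0 ∷ 32 ∷ 16 ∷ 48 ∷ 8 ∷ 40 ∷ 56 ∷ 4 ∷ 36 ∷ 20 ∷ 12 ∷ 44 ∷ 60 ∷ 2 ∷ 34 ∷ 18 ∷ 10 ∷ 42 ∷ 22 ∷ 62 ∷ 63 ∷ []))
   (clique (0 ∷ 32 ∷ 48 ∷ 8 ∷ 40 ∷ 56 ∷ 4 ∷ 36 ∷ 20 ∷ 12 ∷ 28 ∷ 60 ∷ 2 ∷ 18 ∷ 10 ∷ 26 ∷ 6 ∷ 22 ∷ 62 ∷ 49 ∷ 63 ∷ []))))
   (split 9 2 []
   (clique (0 ∷ 32 ∷ 48 ∷ 8 ∷ 40 ∷ 56 ∷ 4 ∷ 36 ∷ 12 ∷ 44 ∷ 60 ∷ 34 ∷ 10 ∷ 42 ∷ 38 ∷ 14 ∷ 46 ∷ 62 ∷ 33 ∷ 49 ∷ 47 ∷ []))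
   (split 1 22 ((4 ∷ []) ∷ [])
   (clique (0 ∷ 32 ∷ 48 ∷ 8 ∷ 40 ∷ 56 ∷ 4 ∷ 36 ∷ 20 ∷ 12 ∷ 44 ∷ 60 ∷ 2 ∷ 18 ∷ 10 ∷ 26 ∷ 62 ∷ 57 ∷ 45 ∷ 61 ∷ 63 ∷ []))
   (split 2 17 ((4 ∷ []) ∷ [])
   (clique (0 ∷ 16 ∷ 48 ∷ 8 ∷ 24 ∷ 56 ∷ 4 ∷ 20 ∷ 12 ∷ 28 ∷ 60 ∷ 2 ∷ 34 ∷ 10 ∷ 42 ∷ 26 ∷ 14 ∷ 46 ∷ 62 ∷ 31 ∷ 63 ∷ []))
   (clique (0 ∷ 32 ∷ 48 ∷ 8 ∷ 40 ∷ 56 ∷ 4 ∷ 36 ∷ 12 ∷ 44 ∷ 60 ∷ 2 ∷ 34 ∷ 10 ∷ 42 ∷ 46 ∷ 62 ∷ 45 ∷ 61 ∷ 47 ∷ 63 ∷ [])))))))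
   (split 19 8 ((4 ∷ []) ∷ [])
   (split 17 32 []
   (split 10 32 []
   (leaf caseI₀ (2 ∷ 16 ∷ 1 ∷ []))
   (split 10 48 []
   (leaf caseI₁ (16 ∷ 2 ∷ 1 ∷ []))
   (split 2 37 ((4 ∷ 3 ∷ 2 ∷ 1 ∷ 0 ∷ 1 ∷ 3 ∷ 2 ∷ 3 ∷ 4 ∷ []) ∷ [])
   (clique (0 ∷ 32 ∷ 16 ∷ 48 ∷ 8 ∷ 40 ∷ 24 ∷ 56 ∷ 12 ∷ 44 ∷ 28 ∷ 60 ∷ 2 ∷ 18 ∷ 10 ∷ 26 ∷ 14 ∷ 46 ∷ 30 ∷ 62 ∷ 33 ∷ []))
   (clique (0 ∷ 32 ∷ 16 ∷ 48 ∷ 8 ∷ 40 ∷ 24 ∷ 56 ∷ 12 ∷ 44 ∷ 28 ∷ 60 ∷ 2 ∷ 18 ∷ 10 ∷ 26 ∷ 46 ∷ 62 ∷ 45 ∷ 61 ∷ 47 ∷ [])))))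
   (split 2 21 []
   (split 46 16 []
   (split 25 32 []
   (leaf caseIII (1 ∷ 1 ∷ 1 ∷ []))
   (clique (0 ∷ 16 ∷ 48 ∷ 8 ∷ 40 ∷ 24 ∷ 56 ∷ 4 ∷ 12 ∷ 44 ∷ 28 ∷ 60 ∷ 34 ∷ 18 ∷ 10 ∷ 42 ∷ 38 ∷ 14 ∷ 62 ∷ 17 ∷ 39 ∷ [])))
   (split 47 16 []
   (clique (0 ∷ 16 ∷ 48 ∷ 8 ∷ 40 ∷ 24 ∷ 56 ∷ 4 ∷ 12 ∷ 44 ∷ 28 ∷ 60 ∷ 18 ∷ 10 ∷ 42 ∷ 38 ∷ 14 ∷ 46 ∷ 62 ∷ 17 ∷ 63 ∷ []))
   (split 45 16 []
   (split 10 32 []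
   (leaf caseV (1 ∷ 8 ∷ 1 ∷ []))
   (clique (0 ∷ 16 ∷ 48 ∷ 8 ∷ 40 ∷ 24 ∷ 56 ∷ 4 ∷ 36 ∷ 12 ∷ 44 ∷ 28 ∷ 60 ∷ 34 ∷ 18 ∷ 10 ∷ 42 ∷ 26 ∷ 14 ∷ 62 ∷ 17 ∷ [])))
   (clique (0 ∷ 16 ∷ 48 ∷ 8 ∷ 40 ∷ 56 ∷ 4 ∷ 12 ∷ 44 ∷ 60 ∷ 34 ∷ 18 ∷ 10 ∷ 42 ∷ 14 ∷ 46 ∷ 62 ∷ 17 ∷ 49 ∷ 47 ∷ 63 ∷ [])))))
   (split 21 34 []
   (split 10 48 []
   (split 45 16 []
   (leaf caseIII (2 ∷ 1 ∷ 1 ∷ []))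
   (clique (0 ∷ 32 ∷ 16 ∷ 48 ∷ 8 ∷ 40 ∷ 24 ∷ 56 ∷ 4 ∷ 36 ∷ 12 ∷ 44 ∷ 60 ∷ 18 ∷ 42 ∷ 26 ∷ 46 ∷ 62 ∷ 45 ∷ 61 ∷ 63 ∷ [])))
   (split 2 53 []
   (clique (0 ∷ 32 ∷ 16 ∷ 48 ∷ 8 ∷ 40 ∷ 24 ∷ 56 ∷ 4 ∷ 36 ∷ 12 ∷ 44 ∷ 28 ∷ 60 ∷ 10 ∷ 42 ∷ 14 ∷ 46 ∷ 30 ∷ 62 ∷ 17 ∷ []))
   (clique (0 ∷ 32 ∷ 48 ∷ 8 ∷ 40 ∷ 24 ∷ 56 ∷ 4 ∷ 36 ∷ 12 ∷ 44 ∷ 28 ∷ 60 ∷ 42 ∷ 46 ∷ 62 ∷ 17 ∷ 45 ∷ 61 ∷ 47 ∷ 63 ∷ []))))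
   (split 41 2 []
   (clique (0 ∷ 48 ∷ 8 ∷ 40 ∷ 56 ∷ 4 ∷ 36 ∷ 12 ∷ 44 ∷ 60 ∷ 2 ∷ 34 ∷ 18 ∷ 10 ∷ 42 ∷ 6 ∷ 14 ∷ 62 ∷ 49 ∷ 37 ∷ 63 ∷ []))
   (split 1 22 []
   (split 45 16 []
   (clique (0 ∷ 32 ∷ 16 ∷ 48 ∷ 8 ∷ 40 ∷ 24 ∷ 56 ∷ 4 ∷ 36 ∷ 12 ∷ 44 ∷ 28 ∷ 60 ∷ 2 ∷ 18 ∷ 42 ∷ 26 ∷ 46 ∷ 62 ∷ 57 ∷ []))
   (clique (0 ∷ 32 ∷ 16 ∷ 48 ∷ 8 ∷ 40 ∷ 56 ∷ 4 ∷ 12 ∷ 44 ∷ 28 ∷ 60 ∷ 2 ∷ 18 ∷ 42 ∷ 26 ∷ 62 ∷ 57 ∷ 45 ∷ 61 ∷ 63 ∷ [])))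
   (split 16 36 []
   (clique (0 ∷ 32 ∷ 16 ∷ 48 ∷ 8 ∷ 40 ∷ 24 ∷ 56 ∷ 4 ∷ 12 ∷ 28 ∷ 60 ∷ 2 ∷ 34 ∷ 18 ∷ 42 ∷ 62 ∷ 25 ∷ 29 ∷ 61 ∷ 63 ∷ []))
   (split 16 34 []
   (split 33 20 []
   (leaf caseII (2 ∷ 16 ∷ 1 ∷ []))
   (clique (0 ∷ 32 ∷ 16 ∷ 48 ∷ 8 ∷ 40 ∷ 24 ∷ 56 ∷ 4 ∷ 36 ∷ 12 ∷ 44 ∷ 28 ∷ 60 ∷ 2 ∷ 62 ∷ 41 ∷ 45 ∷ 29 ∷ 61 ∷ 63 ∷ [])))
   (clique (0 ∷ 16 ∷ 48 ∷ 8 ∷ 40 ∷ 24 ∷ 56 ∷ 4 ∷ 12 ∷ 44 ∷ 28 ∷ 60 ∷ 2 ∷ 18 ∷ 10 ∷ 42 ∷ 62 ∷ 29 ∷ 61 ∷ 31 ∷ 63 ∷ [])))))))))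
   (split 18 8 ((4 ∷ []) ∷ [])
   (split 2 24 []
   (split 49 8 ((0 ∷ 4 ∷ 3 ∷ 4 ∷ []) ∷ (2 ∷ 1 ∷ 0 ∷ 4 ∷ 3 ∷ 2 ∷ 1 ∷ 3 ∷ 2 ∷ 4 ∷ []) ∷ [])
   (leaf caseII (16 ∷ 32 ∷ 1 ∷ []))
   (split 17 14 ((0 ∷ 4 ∷ 3 ∷ 4 ∷ []) ∷ (2 ∷ 1 ∷ 0 ∷ 4 ∷ 3 ∷ 2 ∷ 1 ∷ 3 ∷ 2 ∷ 4 ∷ []) ∷ [])
   (clique (0 ∷ 32 ∷ 16 ∷ 48 ∷ 8 ∷ 40 ∷ 24 ∷ 56 ∷ 36 ∷ 52 ∷ 12 ∷ 44 ∷ 28 ∷ 60 ∷ 10 ∷ 26 ∷ 46 ∷ 62 ∷ 37 ∷ 53 ∷ 45 ∷ []))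
   (clique (0 ∷ 32 ∷ 16 ∷ 48 ∷ 8 ∷ 40 ∷ 24 ∷ 56 ∷ 36 ∷ 52 ∷ 12 ∷ 44 ∷ 28 ∷ 60 ∷ 10 ∷ 26 ∷ 14 ∷ 46 ∷ 30 ∷ 62 ∷ 45 ∷ []))))
   (split 10 16 []
   (split 38 8 []
   (leaf caseI₁ (2 ∷ 32 ∷ 1 ∷ []))
   (split 37 16 ((1 ∷ 0 ∷ 1 ∷ 3 ∷ []) ∷ [])
   (clique (0 ∷ 32 ∷ 16 ∷ 48 ∷ 8 ∷ 40 ∷ 24 ∷ 56 ∷ 36 ∷ 52 ∷ 12 ∷ 44 ∷ 28 ∷ 60 ∷ 2 ∷ 34 ∷ 26 ∷ 38 ∷ 30 ∷ 62 ∷ 61 ∷ []))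
   (clique (0 ∷ 32 ∷ 16 ∷ 48 ∷ 8 ∷ 40 ∷ 56 ∷ 36 ∷ 52 ∷ 12 ∷ 44 ∷ 60 ∷ 2 ∷ 34 ∷ 38 ∷ 62 ∷ 37 ∷ 53 ∷ 45 ∷ 61 ∷ 39 ∷ []))))
   (split 2 21 []
   (split 38 8 []
   (clique (0 ∷ 16 ∷ 48 ∷ 8 ∷ 40 ∷ 24 ∷ 56 ∷ 52 ∷ 12 ∷ 28 ∷ 60 ∷ 2 ∷ 34 ∷ 10 ∷ 42 ∷ 26 ∷ 14 ∷ 62 ∷ 17 ∷ 49 ∷ 25 ∷ []))
   (clique (0 ∷ 32 ∷ 48 ∷ 8 ∷ 40 ∷ 56 ∷ 36 ∷ 52 ∷ 12 ∷ 44 ∷ 60 ∷ 2 ∷ 34 ∷ 42 ∷ 38 ∷ 46 ∷ 62 ∷ 17 ∷ 49 ∷ 45 ∷ 63 ∷ [])))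
   (split 39 8 []
   (split 42 16 []
   (split 29 32 []
   (leaf caseIII (2 ∷ 1 ∷ 1 ∷ []))
   (clique (0 ∷ 32 ∷ 16 ∷ 48 ∷ 8 ∷ 40 ∷ 24 ∷ 56 ∷ 36 ∷ 52 ∷ 12 ∷ 44 ∷ 28 ∷ 60 ∷ 2 ∷ 34 ∷ 26 ∷ 30 ∷ 62 ∷ 29 ∷ 63 ∷ [])))
   (clique (0 ∷ 32 ∷ 16 ∷ 48 ∷ 8 ∷ 40 ∷ 24 ∷ 56 ∷ 36 ∷ 52 ∷ 12 ∷ 44 ∷ 28 ∷ 60 ∷ 2 ∷ 34 ∷ 42 ∷ 26 ∷ 62 ∷ 61 ∷ 63 ∷ [])))
   (split 7 24 []
   (split 31 32 []
   (clique (0 ∷ 32 ∷ 16 ∷ 48 ∷ 8 ∷ 40 ∷ 24 ∷ 56 ∷ 52 ∷ 12 ∷ 28 ∷ 60 ∷ 2 ∷ 34 ∷ 42 ∷ 26 ∷ 30 ∷ 62 ∷ 25 ∷ 29 ∷ 63 ∷ []))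
   (clique (0 ∷ 32 ∷ 16 ∷ 48 ∷ 8 ∷ 40 ∷ 24 ∷ 56 ∷ 52 ∷ 12 ∷ 28 ∷ 60 ∷ 2 ∷ 34 ∷ 42 ∷ 62 ∷ 25 ∷ 29 ∷ 61 ∷ 31 ∷ 63 ∷ [])))
   (split 14 16 []
   (clique (0 ∷ 32 ∷ 16 ∷ 48 ∷ 8 ∷ 40 ∷ 56 ∷ 36 ∷ 52 ∷ 12 ∷ 44 ∷ 60 ∷ 2 ∷ 34 ∷ 42 ∷ 38 ∷ 62 ∷ 49 ∷ 57 ∷ 45 ∷ 61 ∷ []))
   (split 6 16 []
   (split 29 32 []
   (clique (0 ∷ 32 ∷ 16 ∷ 48 ∷ 8 ∷ 40 ∷ 24 ∷ 56 ∷ 36 ∷ 52 ∷ 12 ∷ 44 ∷ 28 ∷ 60 ∷ 2 ∷ 34 ∷ 30 ∷ 62 ∷ 33 ∷ 49 ∷ 57 ∷ []))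
   (clique (0 ∷ 32 ∷ 16 ∷ 48 ∷ 8 ∷ 40 ∷ 56 ∷ 36 ∷ 52 ∷ 12 ∷ 44 ∷ 60 ∷ 2 ∷ 34 ∷ 62 ∷ 49 ∷ 57 ∷ 45 ∷ 29 ∷ 61 ∷ 63 ∷ [])))
   (split 2 17 []
   (clique (0 ∷ 16 ∷ 48 ∷ 8 ∷ 40 ∷ 24 ∷ 56 ∷ 52 ∷ 12 ∷ 44 ∷ 28 ∷ 60 ∷ 2 ∷ 10 ∷ 42 ∷ 14 ∷ 46 ∷ 62 ∷ 45 ∷ 31 ∷ 63 ∷ []))
   (clique (0 ∷ 16 ∷ 48 ∷ 8 ∷ 40 ∷ 24 ∷ 56 ∷ 52 ∷ 12 ∷ 44 ∷ 28 ∷ 60 ∷ 2 ∷ 62 ∷ 17 ∷ 57 ∷ 45 ∷ 29 ∷ 61 ∷ 31 ∷ 63 ∷ []))))))))))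
   (split 2 24 ((4 ∷ []) ∷ [])
   (split 55 8 []
   (clique (0 ∷ 16 ∷ 48 ∷ 8 ∷ 24 ∷ 56 ∷ 4 ∷ 20 ∷ 52 ∷ 12 ∷ 28 ∷ 60 ∷ 18 ∷ 10 ∷ 54 ∷ 17 ∷ 21 ∷ 61 ∷ 23 ∷ 31 ∷ 63 ∷ []))
   (split 23 8 []
   (clique (0 ∷ 32 ∷ 48 ∷ 8 ∷ 40 ∷ 24 ∷ 56 ∷ 4 ∷ 36 ∷ 52 ∷ 12 ∷ 44 ∷ 60 ∷ 42 ∷ 54 ∷ 62 ∷ 21 ∷ 45 ∷ 61 ∷ 47 ∷ 63 ∷ []))
   (split 7 40 []
   (clique (0 ∷ 32 ∷ 16 ∷ 48 ∷ 8 ∷ 40 ∷ 24 ∷ 56 ∷ 4 ∷ 36 ∷ 20 ∷ 52 ∷ 12 ∷ 44 ∷ 28 ∷ 60 ∷ 18 ∷ 42 ∷ 17 ∷ 41 ∷ 61 ∷ []))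
   (split 36 18 []
   (clique (0 ∷ 32 ∷ 16 ∷ 48 ∷ 8 ∷ 40 ∷ 24 ∷ 56 ∷ 4 ∷ 36 ∷ 20 ∷ 52 ∷ 12 ∷ 44 ∷ 28 ∷ 60 ∷ 22 ∷ 54 ∷ 30 ∷ 62 ∷ 23 ∷ []))
   (split 32 19 []
   (clique (0 ∷ 32 ∷ 16 ∷ 48 ∷ 8 ∷ 40 ∷ 24 ∷ 56 ∷ 4 ∷ 36 ∷ 52 ∷ 12 ∷ 44 ∷ 60 ∷ 18 ∷ 54 ∷ 62 ∷ 45 ∷ 61 ∷ 55 ∷ 63 ∷ []))
   (split 32 27 []
   (split 45 16 []
   (clique (0 ∷ 32 ∷ 16 ∷ 48 ∷ 40 ∷ 24 ∷ 56 ∷ 4 ∷ 36 ∷ 20 ∷ 52 ∷ 12 ∷ 44 ∷ 60 ∷ 18 ∷ 26 ∷ 54 ∷ 46 ∷ 62 ∷ 17 ∷ 37 ∷ []))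
   (clique (0 ∷ 32 ∷ 16 ∷ 48 ∷ 24 ∷ 56 ∷ 4 ∷ 36 ∷ 20 ∷ 52 ∷ 12 ∷ 60 ∷ 18 ∷ 26 ∷ 54 ∷ 62 ∷ 49 ∷ 37 ∷ 45 ∷ 61 ∷ 63 ∷ [])))
   (clique (0 ∷ 16 ∷ 48 ∷ 8 ∷ 24 ∷ 56 ∷ 4 ∷ 20 ∷ 52 ∷ 12 ∷ 28 ∷ 60 ∷ 18 ∷ 22 ∷ 54 ∷ 62 ∷ 61 ∷ 23 ∷ 55 ∷ 31 ∷ 63 ∷ []))))))))
   (split 2 56 []
   (split 8 23 ((4 ∷ []) ∷ [])
   (clique (0 ∷ 32 ∷ 48 ∷ 8 ∷ 40 ∷ 56 ∷ 4 ∷ 36 ∷ 52 ∷ 12 ∷ 44 ∷ 60 ∷ 34 ∷ 42 ∷ 38 ∷ 54 ∷ 62 ∷ 53 ∷ 39 ∷ 47 ∷ 63 ∷ []))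
   (split 8 55 []
   (split 10 16 ((4 ∷ []) ∷ [])
   (clique (0 ∷ 16 ∷ 48 ∷ 8 ∷ 40 ∷ 24 ∷ 56 ∷ 4 ∷ 36 ∷ 20 ∷ 52 ∷ 12 ∷ 44 ∷ 60 ∷ 34 ∷ 18 ∷ 38 ∷ 54 ∷ 62 ∷ 53 ∷ 39 ∷ []))
   (clique (0 ∷ 32 ∷ 48 ∷ 8 ∷ 40 ∷ 56 ∷ 4 ∷ 36 ∷ 52 ∷ 12 ∷ 44 ∷ 60 ∷ 34 ∷ 10 ∷ 42 ∷ 38 ∷ 54 ∷ 62 ∷ 37 ∷ 53 ∷ 39 ∷ [])))
   (split 37 8 ((4 ∷ []) ∷ [])
   (split 14 32 []
   (split 20 32 []
   (clique (0 ∷ 32 ∷ 16 ∷ 48 ∷ 8 ∷ 40 ∷ 24 ∷ 56 ∷ 4 ∷ 36 ∷ 52 ∷ 12 ∷ 44 ∷ 60 ∷ 34 ∷ 18 ∷ 26 ∷ 38 ∷ 54 ∷ 62 ∷ 63 ∷ []))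
   (split 16 35 []
   (clique (0 ∷ 32 ∷ 16 ∷ 48 ∷ 8 ∷ 40 ∷ 24 ∷ 56 ∷ 4 ∷ 20 ∷ 52 ∷ 12 ∷ 28 ∷ 60 ∷ 34 ∷ 18 ∷ 26 ∷ 22 ∷ 54 ∷ 62 ∷ 63 ∷ []))
   (clique (0 ∷ 32 ∷ 48 ∷ 8 ∷ 40 ∷ 24 ∷ 56 ∷ 4 ∷ 36 ∷ 52 ∷ 12 ∷ 44 ∷ 28 ∷ 60 ∷ 34 ∷ 10 ∷ 26 ∷ 38 ∷ 54 ∷ 62 ∷ 49 ∷ []))))
   (clique (0 ∷ 16 ∷ 48 ∷ 8 ∷ 24 ∷ 56 ∷ 4 ∷ 20 ∷ 52 ∷ 12 ∷ 28 ∷ 60 ∷ 18 ∷ 26 ∷ 22 ∷ 54 ∷ 30 ∷ 62 ∷ 23 ∷ 31 ∷ 63 ∷ [])))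
   (split 33 8 ((4 ∷ []) ∷ [])
   (split 31 32 []
   (clique (0 ∷ 32 ∷ 48 ∷ 8 ∷ 40 ∷ 24 ∷ 56 ∷ 4 ∷ 36 ∷ 20 ∷ 52 ∷ 12 ∷ 28 ∷ 60 ∷ 34 ∷ 18 ∷ 22 ∷ 54 ∷ 30 ∷ 62 ∷ 23 ∷ []))
   (clique (0 ∷ 32 ∷ 48 ∷ 8 ∷ 24 ∷ 56 ∷ 4 ∷ 36 ∷ 52 ∷ 12 ∷ 28 ∷ 60 ∷ 34 ∷ 18 ∷ 22 ∷ 54 ∷ 14 ∷ 30 ∷ 62 ∷ 31 ∷ 63 ∷ [])))
   (split 1 26 ((4 ∷ []) ∷ [])
   (clique (0 ∷ 32 ∷ 48 ∷ 8 ∷ 24 ∷ 56 ∷ 4 ∷ 36 ∷ 52 ∷ 12 ∷ 28 ∷ 60 ∷ 34 ∷ 18 ∷ 22 ∷ 54 ∷ 62 ∷ 53 ∷ 39 ∷ 55 ∷ 63 ∷ []))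
   (clique (0 ∷ 32 ∷ 48 ∷ 8 ∷ 40 ∷ 56 ∷ 4 ∷ 36 ∷ 52 ∷ 12 ∷ 44 ∷ 60 ∷ 34 ∷ 42 ∷ 38 ∷ 54 ∷ 62 ∷ 39 ∷ 55 ∷ 47 ∷ 63 ∷ [])))))))
   (split 41 2 ((4 ∷ []) ∷ [])
   (split 45 16 []
   (split 7 8 []
   (clique (0 ∷ 16 ∷ 48 ∷ 8 ∷ 40 ∷ 24 ∷ 56 ∷ 4 ∷ 36 ∷ 20 ∷ 52 ∷ 12 ∷ 44 ∷ 60 ∷ 2 ∷ 34 ∷ 18 ∷ 22 ∷ 62 ∷ 37 ∷ 63 ∷ []))
   (clique (0 ∷ 32 ∷ 16 ∷ 48 ∷ 40 ∷ 56 ∷ 4 ∷ 36 ∷ 20 ∷ 52 ∷ 12 ∷ 44 ∷ 60 ∷ 2 ∷ 34 ∷ 18 ∷ 42 ∷ 22 ∷ 54 ∷ 62 ∷ 49 ∷ [])))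
   (split 12 33 []
   (clique (0 ∷ 32 ∷ 48 ∷ 8 ∷ 40 ∷ 56 ∷ 4 ∷ 36 ∷ 52 ∷ 12 ∷ 44 ∷ 60 ∷ 2 ∷ 34 ∷ 18 ∷ 6 ∷ 22 ∷ 54 ∷ 62 ∷ 47 ∷ 63 ∷ []))
   (split 8 33 []
   (clique (0 ∷ 32 ∷ 48 ∷ 8 ∷ 40 ∷ 56 ∷ 4 ∷ 36 ∷ 52 ∷ 12 ∷ 44 ∷ 60 ∷ 2 ∷ 34 ∷ 18 ∷ 6 ∷ 22 ∷ 54 ∷ 14 ∷ 30 ∷ 62 ∷ []))
   (clique (0 ∷ 16 ∷ 48 ∷ 56 ∷ 4 ∷ 20 ∷ 52 ∷ 12 ∷ 28 ∷ 60 ∷ 2 ∷ 18 ∷ 26 ∷ 6 ∷ 22 ∷ 54 ∷ 62 ∷ 29 ∷ 23 ∷ 31 ∷ 63 ∷ [])))))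
   (split 1 22 ((4 ∷ []) ∷ [])
   (split 33 8 []
   (split 25 32 []
   (clique (0 ∷ 32 ∷ 48 ∷ 8 ∷ 40 ∷ 24 ∷ 56 ∷ 4 ∷ 36 ∷ 20 ∷ 52 ∷ 12 ∷ 44 ∷ 28 ∷ 60 ∷ 2 ∷ 18 ∷ 42 ∷ 38 ∷ 62 ∷ 17 ∷ []))
   (clique (0 ∷ 32 ∷ 48 ∷ 8 ∷ 40 ∷ 56 ∷ 4 ∷ 36 ∷ 52 ∷ 12 ∷ 44 ∷ 28 ∷ 60 ∷ 2 ∷ 34 ∷ 18 ∷ 62 ∷ 57 ∷ 45 ∷ 61 ∷ 63 ∷ [])))
   (clique (0 ∷ 32 ∷ 48 ∷ 8 ∷ 40 ∷ 56 ∷ 4 ∷ 36 ∷ 52 ∷ 12 ∷ 44 ∷ 60 ∷ 2 ∷ 34 ∷ 18 ∷ 54 ∷ 62 ∷ 57 ∷ 45 ∷ 61 ∷ 63 ∷ [])))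
   (split 57 2 []
   (split 7 24 ((4 ∷ []) ∷ [])
   (clique (0 ∷ 48 ∷ 8 ∷ 24 ∷ 56 ∷ 4 ∷ 36 ∷ 52 ∷ 12 ∷ 44 ∷ 28 ∷ 60 ∷ 2 ∷ 34 ∷ 10 ∷ 26 ∷ 6 ∷ 62 ∷ 25 ∷ 37 ∷ 45 ∷ []))
   (clique (0 ∷ 32 ∷ 48 ∷ 40 ∷ 56 ∷ 4 ∷ 36 ∷ 52 ∷ 12 ∷ 44 ∷ 60 ∷ 2 ∷ 34 ∷ 6 ∷ 38 ∷ 54 ∷ 62 ∷ 41 ∷ 45 ∷ 47 ∷ 63 ∷ [])))
   (split 1 6 []
   (split 38 8 ((4 ∷ []) ∷ [])
   (clique (0 ∷ 32 ∷ 48 ∷ 8 ∷ 24 ∷ 56 ∷ 4 ∷ 36 ∷ 52 ∷ 12 ∷ 44 ∷ 28 ∷ 60 ∷ 2 ∷ 34 ∷ 46 ∷ 30 ∷ 62 ∷ 45 ∷ 61 ∷ 47 ∷ []))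
   (clique (0 ∷ 32 ∷ 48 ∷ 40 ∷ 56 ∷ 4 ∷ 36 ∷ 52 ∷ 12 ∷ 44 ∷ 60 ∷ 2 ∷ 34 ∷ 42 ∷ 38 ∷ 54 ∷ 46 ∷ 62 ∷ 45 ∷ 61 ∷ 47 ∷ [])))
   (clique (0 ∷ 32 ∷ 48 ∷ 8 ∷ 40 ∷ 56 ∷ 4 ∷ 36 ∷ 52 ∷ 12 ∷ 44 ∷ 60 ∷ 2 ∷ 34 ∷ 62 ∷ 41 ∷ 57 ∷ 45 ∷ 61 ∷ 47 ∷ 63 ∷ [])))))))))))))
   -- Still s₀ + s₁ = s₂, but now neither s₀ nor s₁ is a sum of two of s₃, s₄, s₅. The split asks
   -- whether s₂ has the second representation s₄ + s₅.
   (split 48 4 ((3 ∷ 4 ∷ []) ∷ [])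
   (split 34 8 ((4 ∷ []) ∷ (0 ∷ []) ∷ [])
   (split 7 40 ((3 ∷ 2 ∷ 1 ∷ 0 ∷ 4 ∷ 3 ∷ 2 ∷ 1 ∷ 3 ∷ 2 ∷ 4 ∷ 3 ∷ []) ∷ [])
   (split 2 49 []
   (leaf caseII (1 ∷ 32 ∷ 1 ∷ []))
   (split 2 41 []
   (clique (0 ∷ 32 ∷ 16 ∷ 48 ∷ 8 ∷ 40 ∷ 24 ∷ 56 ∷ 36 ∷ 44 ∷ 28 ∷ 60 ∷ 2 ∷ 18 ∷ 10 ∷ 26 ∷ 58 ∷ 46 ∷ 30 ∷ 62 ∷ 49 ∷ []))
   (split 16 45 []
   (split 26 32 []
   (leaf caseIV (8 ∷ 1 ∷ 1 ∷ []))
   (clique (0 ∷ 32 ∷ 16 ∷ 48 ∷ 8 ∷ 40 ∷ 24 ∷ 56 ∷ 36 ∷ 44 ∷ 28 ∷ 60 ∷ 2 ∷ 18 ∷ 10 ∷ 26 ∷ 58 ∷ 46 ∷ 49 ∷ 41 ∷ 57 ∷ [])))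
   (clique (0 ∷ 32 ∷ 16 ∷ 48 ∷ 8 ∷ 40 ∷ 24 ∷ 56 ∷ 36 ∷ 44 ∷ 28 ∷ 60 ∷ 2 ∷ 10 ∷ 58 ∷ 46 ∷ 62 ∷ 57 ∷ 61 ∷ 47 ∷ 63 ∷ [])))))
   (split 19 32 ((3 ∷ 2 ∷ 1 ∷ 0 ∷ 4 ∷ 3 ∷ 2 ∷ 1 ∷ 3 ∷ 2 ∷ 4 ∷ 3 ∷ []) ∷ [])
   (clique (0 ∷ 32 ∷ 16 ∷ 48 ∷ 8 ∷ 40 ∷ 24 ∷ 56 ∷ 36 ∷ 52 ∷ 44 ∷ 60 ∷ 2 ∷ 18 ∷ 42 ∷ 58 ∷ 46 ∷ 62 ∷ 41 ∷ 57 ∷ 47 ∷ []))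
   (split 23 8 ((3 ∷ 2 ∷ 1 ∷ 0 ∷ 4 ∷ 3 ∷ 2 ∷ 1 ∷ 3 ∷ 2 ∷ 4 ∷ 3 ∷ []) ∷ [])
   (clique (0 ∷ 32 ∷ 48 ∷ 8 ∷ 40 ∷ 24 ∷ 56 ∷ 36 ∷ 20 ∷ 52 ∷ 44 ∷ 28 ∷ 60 ∷ 2 ∷ 10 ∷ 42 ∷ 58 ∷ 46 ∷ 17 ∷ 57 ∷ 47 ∷ []))
   (split 5 40 []
   (split 31 32 ((0 ∷ 4 ∷ []) ∷ [])
   (clique (0 ∷ 32 ∷ 16 ∷ 48 ∷ 8 ∷ 40 ∷ 24 ∷ 56 ∷ 36 ∷ 20 ∷ 52 ∷ 44 ∷ 28 ∷ 60 ∷ 2 ∷ 26 ∷ 58 ∷ 22 ∷ 46 ∷ 30 ∷ 62 ∷ []))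
   (clique (0 ∷ 32 ∷ 16 ∷ 48 ∷ 8 ∷ 40 ∷ 24 ∷ 56 ∷ 36 ∷ 20 ∷ 52 ∷ 44 ∷ 28 ∷ 60 ∷ 2 ∷ 58 ∷ 46 ∷ 62 ∷ 1 ∷ 57 ∷ 61 ∷ [])))
   (clique (0 ∷ 16 ∷ 48 ∷ 8 ∷ 24 ∷ 56 ∷ 20 ∷ 52 ∷ 28 ∷ 60 ∷ 2 ∷ 18 ∷ 26 ∷ 58 ∷ 22 ∷ 30 ∷ 62 ∷ 29 ∷ 23 ∷ 31 ∷ 63 ∷ []))))))
   (split 6 8 ((0 ∷ []) ∷ (3 ∷ 2 ∷ 1 ∷ 0 ∷ 4 ∷ 3 ∷ 2 ∷ 1 ∷ 3 ∷ 2 ∷ 4 ∷ 3 ∷ []) ∷ [])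
   (split 2 17 ((4 ∷ []) ∷ [])
   (clique (0 ∷ 16 ∷ 48 ∷ 8 ∷ 40 ∷ 24 ∷ 56 ∷ 20 ∷ 52 ∷ 28 ∷ 60 ∷ 2 ∷ 34 ∷ 10 ∷ 42 ∷ 58 ∷ 46 ∷ 62 ∷ 1 ∷ 31 ∷ 63 ∷ []))
   (split 2 49 []
   (clique (0 ∷ 32 ∷ 48 ∷ 8 ∷ 40 ∷ 56 ∷ 36 ∷ 52 ∷ 44 ∷ 60 ∷ 2 ∷ 34 ∷ 10 ∷ 42 ∷ 58 ∷ 46 ∷ 62 ∷ 1 ∷ 33 ∷ 41 ∷ 47 ∷ []))
   (clique (0 ∷ 32 ∷ 48 ∷ 8 ∷ 40 ∷ 56 ∷ 36 ∷ 52 ∷ 44 ∷ 60 ∷ 2 ∷ 34 ∷ 10 ∷ 42 ∷ 58 ∷ 46 ∷ 62 ∷ 41 ∷ 57 ∷ 47 ∷ 63 ∷ []))))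
   (split 7 8 []
   (split 9 2 ((0 ∷ []) ∷ (3 ∷ 2 ∷ 1 ∷ 0 ∷ 4 ∷ 3 ∷ 2 ∷ 1 ∷ 3 ∷ 2 ∷ 4 ∷ 3 ∷ []) ∷ [])
   (clique (0 ∷ 32 ∷ 48 ∷ 8 ∷ 40 ∷ 56 ∷ 36 ∷ 44 ∷ 60 ∷ 2 ∷ 34 ∷ 50 ∷ 10 ∷ 42 ∷ 58 ∷ 38 ∷ 46 ∷ 62 ∷ 49 ∷ 37 ∷ 47 ∷ []))
   (split 9 34 ((4 ∷ []) ∷ (0 ∷ []) ∷ (3 ∷ 2 ∷ 1 ∷ 0 ∷ 4 ∷ 3 ∷ 2 ∷ 1 ∷ 3 ∷ 2 ∷ 4 ∷ 3 ∷ []) ∷ [])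
   (clique (0 ∷ 16 ∷ 48 ∷ 8 ∷ 24 ∷ 56 ∷ 20 ∷ 28 ∷ 60 ∷ 2 ∷ 34 ∷ 18 ∷ 50 ∷ 10 ∷ 42 ∷ 26 ∷ 58 ∷ 62 ∷ 17 ∷ 31 ∷ 63 ∷ []))
   (split 9 50 ((0 ∷ []) ∷ (3 ∷ 2 ∷ 1 ∷ 0 ∷ 4 ∷ 3 ∷ 2 ∷ 1 ∷ 3 ∷ 2 ∷ 4 ∷ 3 ∷ []) ∷ [])
   (clique (0 ∷ 32 ∷ 48 ∷ 8 ∷ 40 ∷ 56 ∷ 36 ∷ 44 ∷ 60 ∷ 2 ∷ 34 ∷ 50 ∷ 10 ∷ 42 ∷ 58 ∷ 38 ∷ 46 ∷ 62 ∷ 1 ∷ 33 ∷ 47 ∷ []))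
   (split 1 34 ((4 ∷ []) ∷ (0 ∷ []) ∷ (3 ∷ 2 ∷ 1 ∷ 0 ∷ 4 ∷ 3 ∷ 2 ∷ 1 ∷ 3 ∷ 2 ∷ 4 ∷ 3 ∷ []) ∷ [])
   (clique (0 ∷ 16 ∷ 48 ∷ 8 ∷ 24 ∷ 56 ∷ 36 ∷ 20 ∷ 28 ∷ 60 ∷ 2 ∷ 34 ∷ 50 ∷ 10 ∷ 42 ∷ 26 ∷ 58 ∷ 38 ∷ 46 ∷ 62 ∷ 61 ∷ []))
   (clique (0 ∷ 32 ∷ 16 ∷ 48 ∷ 8 ∷ 40 ∷ 24 ∷ 56 ∷ 36 ∷ 20 ∷ 60 ∷ 2 ∷ 34 ∷ 18 ∷ 50 ∷ 10 ∷ 38 ∷ 22 ∷ 1 ∷ 49 ∷ 9 ∷ []))))))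
   (split 37 8 ((4 ∷ []) ∷ (0 ∷ []) ∷ [])
   (clique (0 ∷ 16 ∷ 48 ∷ 8 ∷ 24 ∷ 56 ∷ 20 ∷ 52 ∷ 28 ∷ 60 ∷ 26 ∷ 1 ∷ 17 ∷ 49 ∷ 25 ∷ 57 ∷ 21 ∷ 29 ∷ 61 ∷ 31 ∷ 63 ∷ []))
   (clique (0 ∷ 32 ∷ 48 ∷ 8 ∷ 40 ∷ 56 ∷ 36 ∷ 52 ∷ 44 ∷ 60 ∷ 2 ∷ 34 ∷ 50 ∷ 10 ∷ 42 ∷ 58 ∷ 38 ∷ 46 ∷ 62 ∷ 47 ∷ 63 ∷ []))))))
   (split 16 6 ((0 ∷ 3 ∷ 4 ∷ []) ∷ [])
   (split 58 4 []
   (split 29 2 ((4 ∷ 3 ∷ 4 ∷ []) ∷ [])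
   (clique (0 ∷ 32 ∷ 16 ∷ 48 ∷ 56 ∷ 4 ∷ 36 ∷ 52 ∷ 44 ∷ 60 ∷ 2 ∷ 34 ∷ 50 ∷ 42 ∷ 62 ∷ 49 ∷ 25 ∷ 57 ∷ 21 ∷ 13 ∷ 63 ∷ []))
   (split 8 20 ((4 ∷ 3 ∷ 4 ∷ []) ∷ [])
   (split 9 32 []
   (clique (0 ∷ 32 ∷ 16 ∷ 48 ∷ 8 ∷ 40 ∷ 24 ∷ 56 ∷ 4 ∷ 36 ∷ 12 ∷ 44 ∷ 28 ∷ 60 ∷ 2 ∷ 18 ∷ 10 ∷ 42 ∷ 26 ∷ 30 ∷ 62 ∷ []))
   (clique (0 ∷ 16 ∷ 48 ∷ 8 ∷ 40 ∷ 56 ∷ 4 ∷ 36 ∷ 12 ∷ 44 ∷ 60 ∷ 2 ∷ 34 ∷ 50 ∷ 42 ∷ 62 ∷ 49 ∷ 9 ∷ 41 ∷ 57 ∷ 63 ∷ [])))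
   (split 8 21 ((4 ∷ 3 ∷ 4 ∷ []) ∷ [])
   (clique (0 ∷ 32 ∷ 16 ∷ 48 ∷ 8 ∷ 40 ∷ 56 ∷ 4 ∷ 36 ∷ 20 ∷ 52 ∷ 44 ∷ 60 ∷ 2 ∷ 34 ∷ 42 ∷ 54 ∷ 62 ∷ 49 ∷ 57 ∷ 63 ∷ []))
   (clique (0 ∷ 32 ∷ 16 ∷ 48 ∷ 56 ∷ 4 ∷ 36 ∷ 20 ∷ 52 ∷ 60 ∷ 2 ∷ 34 ∷ 50 ∷ 42 ∷ 54 ∷ 62 ∷ 49 ∷ 21 ∷ 53 ∷ 55 ∷ 63 ∷ [])))))
   (split 10 1 ((4 ∷ 3 ∷ 4 ∷ []) ∷ [])
   (split 61 2 []
   (split 8 18 []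
   (clique (0 ∷ 16 ∷ 48 ∷ 8 ∷ 40 ∷ 24 ∷ 56 ∷ 4 ∷ 36 ∷ 20 ∷ 52 ∷ 12 ∷ 44 ∷ 60 ∷ 2 ∷ 10 ∷ 42 ∷ 26 ∷ 58 ∷ 62 ∷ 57 ∷ []))
   (split 18 32 []
   (clique (0 ∷ 32 ∷ 16 ∷ 48 ∷ 40 ∷ 24 ∷ 56 ∷ 4 ∷ 36 ∷ 20 ∷ 52 ∷ 44 ∷ 28 ∷ 60 ∷ 2 ∷ 34 ∷ 10 ∷ 58 ∷ 62 ∷ 57 ∷ 45 ∷ []))
   (split 18 33 []
   (clique (0 ∷ 32 ∷ 16 ∷ 48 ∷ 24 ∷ 56 ∷ 4 ∷ 36 ∷ 20 ∷ 52 ∷ 28 ∷ 60 ∷ 2 ∷ 34 ∷ 18 ∷ 10 ∷ 26 ∷ 58 ∷ 30 ∷ 62 ∷ 57 ∷ []))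
   (clique (0 ∷ 16 ∷ 8 ∷ 24 ∷ 56 ∷ 4 ∷ 12 ∷ 44 ∷ 28 ∷ 60 ∷ 2 ∷ 18 ∷ 10 ∷ 26 ∷ 58 ∷ 30 ∷ 62 ∷ 25 ∷ 57 ∷ 45 ∷ 63 ∷ [])))))
   (split 19 8 []
   (clique (0 ∷ 16 ∷ 8 ∷ 40 ∷ 24 ∷ 56 ∷ 4 ∷ 36 ∷ 12 ∷ 44 ∷ 60 ∷ 2 ∷ 18 ∷ 10 ∷ 42 ∷ 26 ∷ 58 ∷ 62 ∷ 57 ∷ 45 ∷ 61 ∷ []))
   (split 40 16 []
   (split 24 32 []
   (clique (0 ∷ 32 ∷ 16 ∷ 48 ∷ 8 ∷ 56 ∷ 4 ∷ 36 ∷ 20 ∷ 52 ∷ 12 ∷ 60 ∷ 2 ∷ 34 ∷ 18 ∷ 50 ∷ 10 ∷ 58 ∷ 54 ∷ 62 ∷ 55 ∷ []))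
   (clique (0 ∷ 32 ∷ 16 ∷ 48 ∷ 24 ∷ 56 ∷ 4 ∷ 36 ∷ 20 ∷ 52 ∷ 60 ∷ 2 ∷ 18 ∷ 10 ∷ 26 ∷ 58 ∷ 30 ∷ 62 ∷ 57 ∷ 61 ∷ 55 ∷ [])))
   (split 32 18 []
   (clique (0 ∷ 32 ∷ 16 ∷ 8 ∷ 40 ∷ 24 ∷ 56 ∷ 4 ∷ 36 ∷ 20 ∷ 44 ∷ 28 ∷ 60 ∷ 2 ∷ 10 ∷ 58 ∷ 62 ∷ 57 ∷ 45 ∷ 61 ∷ 63 ∷ []))
   (clique (0 ∷ 16 ∷ 8 ∷ 24 ∷ 56 ∷ 4 ∷ 20 ∷ 12 ∷ 44 ∷ 28 ∷ 60 ∷ 2 ∷ 10 ∷ 26 ∷ 58 ∷ 30 ∷ 62 ∷ 25 ∷ 57 ∷ 61 ∷ 63 ∷ []))))))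
   (split 18 8 ((4 ∷ 3 ∷ 4 ∷ []) ∷ [])
   (split 48 10 []
   (split 5 2 []
   (leaf caseII (1 ∷ 4 ∷ 1 ∷ []))
   (clique (0 ∷ 32 ∷ 16 ∷ 48 ∷ 8 ∷ 40 ∷ 24 ∷ 56 ∷ 4 ∷ 20 ∷ 12 ∷ 44 ∷ 28 ∷ 60 ∷ 2 ∷ 34 ∷ 42 ∷ 58 ∷ 30 ∷ 62 ∷ 63 ∷ [])))
   (split 10 52 []
   (split 32 20 []
   (clique (0 ∷ 32 ∷ 16 ∷ 48 ∷ 8 ∷ 40 ∷ 24 ∷ 56 ∷ 4 ∷ 36 ∷ 52 ∷ 12 ∷ 44 ∷ 60 ∷ 2 ∷ 42 ∷ 26 ∷ 58 ∷ 62 ∷ 17 ∷ 63 ∷ []))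
   (clique (0 ∷ 32 ∷ 16 ∷ 48 ∷ 8 ∷ 40 ∷ 24 ∷ 56 ∷ 4 ∷ 36 ∷ 20 ∷ 52 ∷ 12 ∷ 44 ∷ 60 ∷ 2 ∷ 42 ∷ 26 ∷ 58 ∷ 30 ∷ 62 ∷ [])))
   (split 36 24 []
   (split 34 20 []
   (clique (0 ∷ 32 ∷ 16 ∷ 48 ∷ 8 ∷ 40 ∷ 24 ∷ 56 ∷ 4 ∷ 20 ∷ 52 ∷ 12 ∷ 44 ∷ 28 ∷ 60 ∷ 2 ∷ 58 ∷ 62 ∷ 1 ∷ 57 ∷ 61 ∷ []))
   (clique (0 ∷ 32 ∷ 16 ∷ 48 ∷ 8 ∷ 40 ∷ 24 ∷ 56 ∷ 4 ∷ 20 ∷ 52 ∷ 12 ∷ 44 ∷ 28 ∷ 60 ∷ 2 ∷ 34 ∷ 42 ∷ 58 ∷ 62 ∷ 57 ∷ [])))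
   (split 36 10 []
   (split 20 32 []
   (clique (0 ∷ 32 ∷ 16 ∷ 48 ∷ 8 ∷ 40 ∷ 24 ∷ 56 ∷ 4 ∷ 36 ∷ 52 ∷ 12 ∷ 44 ∷ 60 ∷ 2 ∷ 42 ∷ 58 ∷ 62 ∷ 1 ∷ 17 ∷ 57 ∷ []))
   (clique (0 ∷ 32 ∷ 16 ∷ 48 ∷ 8 ∷ 40 ∷ 24 ∷ 56 ∷ 4 ∷ 36 ∷ 20 ∷ 52 ∷ 12 ∷ 44 ∷ 28 ∷ 60 ∷ 2 ∷ 58 ∷ 30 ∷ 62 ∷ 57 ∷ [])))
   (clique (0 ∷ 16 ∷ 48 ∷ 8 ∷ 40 ∷ 24 ∷ 56 ∷ 4 ∷ 20 ∷ 52 ∷ 12 ∷ 44 ∷ 60 ∷ 2 ∷ 10 ∷ 42 ∷ 26 ∷ 58 ∷ 62 ∷ 57 ∷ 63 ∷ []))))))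
   (split 6 9 ((4 ∷ 3 ∷ 4 ∷ []) ∷ [])
   (split 62 1 []
   (clique (0 ∷ 16 ∷ 48 ∷ 56 ∷ 4 ∷ 36 ∷ 20 ∷ 52 ∷ 44 ∷ 60 ∷ 2 ∷ 58 ∷ 22 ∷ 54 ∷ 62 ∷ 17 ∷ 49 ∷ 5 ∷ 61 ∷ 55 ∷ 63 ∷ []))
   (split 8 36 []
   (split 32 20 []
   (split 1 58 []
   (leaf caseIII (4 ∷ 1 ∷ 1 ∷ []))
   (clique (0 ∷ 32 ∷ 16 ∷ 48 ∷ 8 ∷ 40 ∷ 24 ∷ 56 ∷ 4 ∷ 12 ∷ 44 ∷ 60 ∷ 2 ∷ 34 ∷ 42 ∷ 26 ∷ 58 ∷ 62 ∷ 1 ∷ 17 ∷ 5 ∷ [])))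
   (split 32 17 []
   (clique (0 ∷ 32 ∷ 16 ∷ 48 ∷ 8 ∷ 40 ∷ 24 ∷ 56 ∷ 4 ∷ 20 ∷ 12 ∷ 44 ∷ 28 ∷ 60 ∷ 2 ∷ 26 ∷ 58 ∷ 30 ∷ 62 ∷ 1 ∷ 5 ∷ []))
   (clique (0 ∷ 32 ∷ 16 ∷ 48 ∷ 8 ∷ 24 ∷ 56 ∷ 4 ∷ 20 ∷ 12 ∷ 44 ∷ 28 ∷ 60 ∷ 2 ∷ 34 ∷ 26 ∷ 58 ∷ 22 ∷ 30 ∷ 62 ∷ 63 ∷ []))))
   (split 8 17 []
   (split 36 24 []
   (leaf caseII (1 ∷ 2 ∷ 1 ∷ []))
   (clique (0 ∷ 16 ∷ 48 ∷ 8 ∷ 40 ∷ 24 ∷ 56 ∷ 4 ∷ 36 ∷ 20 ∷ 52 ∷ 12 ∷ 44 ∷ 60 ∷ 2 ∷ 34 ∷ 58 ∷ 22 ∷ 54 ∷ 62 ∷ 1 ∷ [])))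
   (clique (0 ∷ 16 ∷ 48 ∷ 8 ∷ 24 ∷ 56 ∷ 4 ∷ 20 ∷ 52 ∷ 12 ∷ 44 ∷ 28 ∷ 60 ∷ 2 ∷ 22 ∷ 54 ∷ 62 ∷ 1 ∷ 17 ∷ 61 ∷ 63 ∷ [])))))
   (split 2 9 ((4 ∷ 3 ∷ 4 ∷ []) ∷ [])
   (split 14 32 []
   (clique (0 ∷ 32 ∷ 16 ∷ 48 ∷ 8 ∷ 40 ∷ 56 ∷ 4 ∷ 36 ∷ 12 ∷ 44 ∷ 60 ∷ 2 ∷ 34 ∷ 18 ∷ 50 ∷ 10 ∷ 42 ∷ 58 ∷ 62 ∷ 63 ∷ []))
   (split 28 32 []
   (clique (0 ∷ 32 ∷ 16 ∷ 48 ∷ 24 ∷ 56 ∷ 4 ∷ 36 ∷ 20 ∷ 52 ∷ 12 ∷ 44 ∷ 60 ∷ 2 ∷ 34 ∷ 18 ∷ 50 ∷ 26 ∷ 58 ∷ 22 ∷ 54 ∷ []))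
   (split 24 36 []
   (clique (0 ∷ 32 ∷ 16 ∷ 48 ∷ 8 ∷ 24 ∷ 56 ∷ 4 ∷ 52 ∷ 12 ∷ 44 ∷ 28 ∷ 60 ∷ 2 ∷ 34 ∷ 18 ∷ 50 ∷ 58 ∷ 54 ∷ 62 ∷ 63 ∷ []))
   (split 8 36 []
   (clique (0 ∷ 16 ∷ 48 ∷ 8 ∷ 24 ∷ 56 ∷ 4 ∷ 12 ∷ 44 ∷ 28 ∷ 60 ∷ 2 ∷ 34 ∷ 18 ∷ 50 ∷ 26 ∷ 58 ∷ 30 ∷ 62 ∷ 33 ∷ 63 ∷ []))
   (clique (0 ∷ 32 ∷ 16 ∷ 48 ∷ 56 ∷ 4 ∷ 36 ∷ 52 ∷ 12 ∷ 44 ∷ 28 ∷ 60 ∷ 2 ∷ 34 ∷ 18 ∷ 50 ∷ 58 ∷ 54 ∷ 62 ∷ 49 ∷ 63 ∷ []))))))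
   (split 18 44 []
   (split 34 20 ((4 ∷ 3 ∷ 4 ∷ []) ∷ [])
   (clique (0 ∷ 32 ∷ 16 ∷ 48 ∷ 40 ∷ 56 ∷ 4 ∷ 36 ∷ 20 ∷ 52 ∷ 44 ∷ 28 ∷ 60 ∷ 2 ∷ 50 ∷ 22 ∷ 54 ∷ 1 ∷ 33 ∷ 9 ∷ 5 ∷ []))
   (clique (0 ∷ 32 ∷ 16 ∷ 48 ∷ 56 ∷ 4 ∷ 36 ∷ 20 ∷ 52 ∷ 44 ∷ 60 ∷ 2 ∷ 50 ∷ 22 ∷ 54 ∷ 62 ∷ 17 ∷ 49 ∷ 61 ∷ 55 ∷ 63 ∷ [])))
   (split 2 41 []
   (split 30 1 ((4 ∷ 3 ∷ 4 ∷ []) ∷ [])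
   (split 36 8 []
   (clique (0 ∷ 16 ∷ 48 ∷ 8 ∷ 24 ∷ 56 ∷ 4 ∷ 20 ∷ 12 ∷ 44 ∷ 28 ∷ 60 ∷ 2 ∷ 18 ∷ 50 ∷ 26 ∷ 58 ∷ 22 ∷ 30 ∷ 62 ∷ 9 ∷ []))
   (clique (0 ∷ 32 ∷ 16 ∷ 48 ∷ 24 ∷ 56 ∷ 4 ∷ 36 ∷ 52 ∷ 44 ∷ 60 ∷ 2 ∷ 18 ∷ 26 ∷ 58 ∷ 22 ∷ 30 ∷ 62 ∷ 49 ∷ 37 ∷ 63 ∷ [])))
   (split 26 1 ((4 ∷ 3 ∷ 4 ∷ []) ∷ [])
   (clique (0 ∷ 16 ∷ 8 ∷ 24 ∷ 56 ∷ 4 ∷ 12 ∷ 44 ∷ 28 ∷ 60 ∷ 2 ∷ 18 ∷ 10 ∷ 26 ∷ 58 ∷ 30 ∷ 62 ∷ 17 ∷ 9 ∷ 25 ∷ 63 ∷ []))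
   (clique (0 ∷ 16 ∷ 48 ∷ 56 ∷ 4 ∷ 36 ∷ 20 ∷ 52 ∷ 44 ∷ 60 ∷ 2 ∷ 18 ∷ 50 ∷ 22 ∷ 54 ∷ 62 ∷ 33 ∷ 17 ∷ 49 ∷ 37 ∷ 63 ∷ []))))
   (split 17 32 ((4 ∷ 3 ∷ 4 ∷ []) ∷ [])
   (clique (0 ∷ 32 ∷ 16 ∷ 48 ∷ 40 ∷ 56 ∷ 4 ∷ 36 ∷ 20 ∷ 44 ∷ 28 ∷ 60 ∷ 1 ∷ 33 ∷ 41 ∷ 57 ∷ 5 ∷ 13 ∷ 45 ∷ 61 ∷ 63 ∷ []))
   (split 17 34 ((4 ∷ 3 ∷ 4 ∷ []) ∷ [])
   (clique (0 ∷ 32 ∷ 16 ∷ 48 ∷ 56 ∷ 4 ∷ 36 ∷ 20 ∷ 52 ∷ 44 ∷ 60 ∷ 2 ∷ 34 ∷ 18 ∷ 50 ∷ 42 ∷ 58 ∷ 62 ∷ 49 ∷ 57 ∷ 63 ∷ []))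
   (split 1 42 []
   (split 19 8 ((4 ∷ 3 ∷ 4 ∷ []) ∷ [])
   (clique (0 ∷ 16 ∷ 8 ∷ 40 ∷ 24 ∷ 56 ∷ 4 ∷ 12 ∷ 44 ∷ 28 ∷ 60 ∷ 18 ∷ 50 ∷ 10 ∷ 42 ∷ 26 ∷ 58 ∷ 62 ∷ 25 ∷ 57 ∷ 13 ∷ []))
   (clique (0 ∷ 32 ∷ 16 ∷ 48 ∷ 56 ∷ 4 ∷ 36 ∷ 20 ∷ 52 ∷ 60 ∷ 2 ∷ 34 ∷ 50 ∷ 42 ∷ 58 ∷ 54 ∷ 62 ∷ 49 ∷ 57 ∷ 55 ∷ 63 ∷ [])))
   (clique (0 ∷ 16 ∷ 48 ∷ 56 ∷ 4 ∷ 36 ∷ 20 ∷ 52 ∷ 60 ∷ 2 ∷ 34 ∷ 18 ∷ 50 ∷ 58 ∷ 54 ∷ 62 ∷ 17 ∷ 49 ∷ 57 ∷ 55 ∷ 63 ∷ []))))))))))))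
   (split 16 7 ((3 ∷ 4 ∷ []) ∷ [])
   (split 34 20 ((0 ∷ []) ∷ (4 ∷ 3 ∷ 4 ∷ []) ∷ [])
   (clique (0 ∷ 32 ∷ 16 ∷ 48 ∷ 56 ∷ 4 ∷ 36 ∷ 20 ∷ 52 ∷ 60 ∷ 2 ∷ 18 ∷ 50 ∷ 58 ∷ 6 ∷ 38 ∷ 54 ∷ 46 ∷ 62 ∷ 55 ∷ 63 ∷ []))
   (clique (0 ∷ 32 ∷ 16 ∷ 48 ∷ 56 ∷ 4 ∷ 36 ∷ 52 ∷ 60 ∷ 2 ∷ 34 ∷ 18 ∷ 50 ∷ 58 ∷ 6 ∷ 38 ∷ 54 ∷ 46 ∷ 62 ∷ 55 ∷ 63 ∷ [])))
   (split 6 48 ((0 ∷ 3 ∷ 4 ∷ []) ∷ [])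
   (split 58 4 []
   (split 8 20 ((4 ∷ []) ∷ [])
   (clique (0 ∷ 32 ∷ 48 ∷ 8 ∷ 40 ∷ 56 ∷ 4 ∷ 36 ∷ 12 ∷ 44 ∷ 60 ∷ 2 ∷ 50 ∷ 10 ∷ 42 ∷ 46 ∷ 62 ∷ 41 ∷ 57 ∷ 47 ∷ 63 ∷ []))
   (split 8 21 ((4 ∷ []) ∷ [])
   (clique (0 ∷ 16 ∷ 48 ∷ 8 ∷ 40 ∷ 56 ∷ 4 ∷ 20 ∷ 52 ∷ 12 ∷ 28 ∷ 60 ∷ 2 ∷ 18 ∷ 10 ∷ 42 ∷ 26 ∷ 22 ∷ 30 ∷ 62 ∷ 31 ∷ []))
   (clique (0 ∷ 32 ∷ 48 ∷ 40 ∷ 56 ∷ 4 ∷ 36 ∷ 52 ∷ 12 ∷ 44 ∷ 60 ∷ 2 ∷ 10 ∷ 42 ∷ 46 ∷ 62 ∷ 57 ∷ 37 ∷ 53 ∷ 39 ∷ 47 ∷ []))))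
   (split 36 8 ((4 ∷ []) ∷ [])
   (split 10 1 []
   (clique (0 ∷ 16 ∷ 48 ∷ 8 ∷ 24 ∷ 56 ∷ 4 ∷ 20 ∷ 12 ∷ 28 ∷ 60 ∷ 2 ∷ 34 ∷ 50 ∷ 10 ∷ 26 ∷ 58 ∷ 30 ∷ 62 ∷ 57 ∷ 29 ∷ []))
   (split 10 20 []
   (clique (0 ∷ 32 ∷ 16 ∷ 48 ∷ 8 ∷ 40 ∷ 24 ∷ 56 ∷ 4 ∷ 20 ∷ 12 ∷ 44 ∷ 28 ∷ 60 ∷ 2 ∷ 58 ∷ 30 ∷ 62 ∷ 57 ∷ 29 ∷ 31 ∷ []))
   (clique (0 ∷ 16 ∷ 48 ∷ 8 ∷ 24 ∷ 56 ∷ 4 ∷ 20 ∷ 12 ∷ 28 ∷ 60 ∷ 2 ∷ 10 ∷ 26 ∷ 58 ∷ 30 ∷ 62 ∷ 49 ∷ 57 ∷ 31 ∷ 63 ∷ []))))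
   (split 36 10 ((4 ∷ []) ∷ [])
   (split 34 16 []
   (clique (0 ∷ 32 ∷ 16 ∷ 48 ∷ 8 ∷ 40 ∷ 24 ∷ 56 ∷ 4 ∷ 36 ∷ 20 ∷ 52 ∷ 12 ∷ 44 ∷ 28 ∷ 60 ∷ 2 ∷ 58 ∷ 30 ∷ 62 ∷ 57 ∷ []))
   (clique (0 ∷ 32 ∷ 48 ∷ 8 ∷ 40 ∷ 24 ∷ 56 ∷ 4 ∷ 36 ∷ 52 ∷ 44 ∷ 60 ∷ 2 ∷ 34 ∷ 42 ∷ 58 ∷ 38 ∷ 46 ∷ 62 ∷ 47 ∷ 63 ∷ [])))
   (split 8 52 []
   (clique (0 ∷ 32 ∷ 48 ∷ 8 ∷ 40 ∷ 56 ∷ 4 ∷ 36 ∷ 12 ∷ 44 ∷ 60 ∷ 2 ∷ 10 ∷ 38 ∷ 46 ∷ 62 ∷ 49 ∷ 57 ∷ 39 ∷ 47 ∷ 63 ∷ []))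
   (clique (0 ∷ 32 ∷ 48 ∷ 8 ∷ 40 ∷ 56 ∷ 4 ∷ 36 ∷ 52 ∷ 12 ∷ 44 ∷ 60 ∷ 2 ∷ 10 ∷ 42 ∷ 58 ∷ 46 ∷ 62 ∷ 57 ∷ 47 ∷ 63 ∷ []))))))
   (split 2 56 ((0 ∷ []) ∷ [])
   (split 1 14 ((3 ∷ 4 ∷ []) ∷ [])
   (split 1 18 ((4 ∷ []) ∷ [])
   (split 20 32 []
   (clique (0 ∷ 32 ∷ 16 ∷ 48 ∷ 40 ∷ 56 ∷ 4 ∷ 36 ∷ 52 ∷ 60 ∷ 34 ∷ 18 ∷ 50 ∷ 10 ∷ 42 ∷ 26 ∷ 58 ∷ 62 ∷ 25 ∷ 61 ∷ 63 ∷ []))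
   (clique (0 ∷ 32 ∷ 16 ∷ 48 ∷ 40 ∷ 56 ∷ 4 ∷ 36 ∷ 20 ∷ 52 ∷ 60 ∷ 18 ∷ 50 ∷ 10 ∷ 42 ∷ 58 ∷ 22 ∷ 54 ∷ 62 ∷ 61 ∷ 63 ∷ [])))
   (clique (0 ∷ 32 ∷ 40 ∷ 56 ∷ 4 ∷ 36 ∷ 12 ∷ 44 ∷ 60 ∷ 10 ∷ 42 ∷ 58 ∷ 14 ∷ 46 ∷ 62 ∷ 41 ∷ 5 ∷ 37 ∷ 61 ∷ 47 ∷ 63 ∷ [])))
   (split 10 1 ((3 ∷ 4 ∷ []) ∷ [])
   (split 12 32 ((4 ∷ []) ∷ [])
   (clique (0 ∷ 32 ∷ 48 ∷ 8 ∷ 24 ∷ 56 ∷ 4 ∷ 36 ∷ 52 ∷ 60 ∷ 34 ∷ 50 ∷ 10 ∷ 42 ∷ 26 ∷ 58 ∷ 38 ∷ 62 ∷ 9 ∷ 25 ∷ 61 ∷ []))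
   (clique (0 ∷ 32 ∷ 48 ∷ 56 ∷ 4 ∷ 36 ∷ 52 ∷ 44 ∷ 60 ∷ 34 ∷ 10 ∷ 42 ∷ 58 ∷ 38 ∷ 14 ∷ 46 ∷ 62 ∷ 61 ∷ 39 ∷ 55 ∷ 63 ∷ [])))
   (split 2 5 []
   (split 18 32 ((3 ∷ 4 ∷ []) ∷ (4 ∷ []) ∷ [])
   (clique (0 ∷ 32 ∷ 16 ∷ 48 ∷ 56 ∷ 4 ∷ 36 ∷ 20 ∷ 52 ∷ 60 ∷ 34 ∷ 50 ∷ 58 ∷ 38 ∷ 54 ∷ 62 ∷ 1 ∷ 17 ∷ 49 ∷ 39 ∷ 55 ∷ []))
   (split 18 36 ((3 ∷ 4 ∷ []) ∷ [])
   (clique (0 ∷ 32 ∷ 16 ∷ 48 ∷ 40 ∷ 24 ∷ 56 ∷ 4 ∷ 36 ∷ 20 ∷ 52 ∷ 44 ∷ 28 ∷ 60 ∷ 50 ∷ 58 ∷ 38 ∷ 22 ∷ 62 ∷ 1 ∷ 49 ∷ []))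
   (split 16 36 ((3 ∷ 4 ∷ []) ∷ (4 ∷ []) ∷ [])
   (clique (0 ∷ 32 ∷ 16 ∷ 40 ∷ 24 ∷ 56 ∷ 4 ∷ 20 ∷ 28 ∷ 60 ∷ 34 ∷ 18 ∷ 42 ∷ 26 ∷ 58 ∷ 22 ∷ 62 ∷ 1 ∷ 33 ∷ 41 ∷ 23 ∷ []))
   (clique (0 ∷ 32 ∷ 48 ∷ 40 ∷ 56 ∷ 4 ∷ 36 ∷ 52 ∷ 44 ∷ 60 ∷ 34 ∷ 50 ∷ 42 ∷ 58 ∷ 38 ∷ 62 ∷ 1 ∷ 33 ∷ 49 ∷ 41 ∷ 39 ∷ [])))))
   (split 5 10 ((3 ∷ 4 ∷ []) ∷ [])
   (clique (0 ∷ 8 ∷ 40 ∷ 56 ∷ 4 ∷ 36 ∷ 12 ∷ 44 ∷ 60 ∷ 10 ∷ 42 ∷ 58 ∷ 14 ∷ 46 ∷ 62 ∷ 1 ∷ 33 ∷ 49 ∷ 41 ∷ 61 ∷ 39 ∷ []))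
   (split 1 26 ((3 ∷ 4 ∷ []) ∷ [])
   (split 36 8 ((3 ∷ []) ∷ [])
   (clique (0 ∷ 32 ∷ 48 ∷ 8 ∷ 24 ∷ 56 ∷ 4 ∷ 12 ∷ 28 ∷ 60 ∷ 34 ∷ 50 ∷ 10 ∷ 26 ∷ 58 ∷ 14 ∷ 30 ∷ 62 ∷ 49 ∷ 41 ∷ 25 ∷ []))
   (clique (0 ∷ 32 ∷ 48 ∷ 56 ∷ 4 ∷ 36 ∷ 52 ∷ 60 ∷ 34 ∷ 18 ∷ 26 ∷ 58 ∷ 38 ∷ 54 ∷ 30 ∷ 62 ∷ 49 ∷ 53 ∷ 61 ∷ 39 ∷ 55 ∷ [])))
   (split 1 30 ((3 ∷ 4 ∷ []) ∷ [])
   (clique (0 ∷ 32 ∷ 48 ∷ 56 ∷ 4 ∷ 36 ∷ 52 ∷ 60 ∷ 34 ∷ 58 ∷ 38 ∷ 22 ∷ 54 ∷ 30 ∷ 62 ∷ 49 ∷ 5 ∷ 37 ∷ 53 ∷ 61 ∷ 39 ∷ []))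
   (clique (0 ∷ 32 ∷ 48 ∷ 56 ∷ 4 ∷ 36 ∷ 52 ∷ 60 ∷ 34 ∷ 50 ∷ 58 ∷ 38 ∷ 54 ∷ 62 ∷ 33 ∷ 49 ∷ 53 ∷ 61 ∷ 39 ∷ 55 ∷ 63 ∷ []))))))))
   (split 4 56 []
   (split 20 32 ((3 ∷ 4 ∷ []) ∷ (4 ∷ []) ∷ [])
   (split 10 16 ((0 ∷ []) ∷ [])
   (split 39 8 []
   (clique (0 ∷ 32 ∷ 16 ∷ 48 ∷ 8 ∷ 40 ∷ 24 ∷ 56 ∷ 36 ∷ 52 ∷ 12 ∷ 44 ∷ 60 ∷ 2 ∷ 34 ∷ 26 ∷ 58 ∷ 38 ∷ 54 ∷ 62 ∷ 1 ∷ []))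
   (clique (0 ∷ 32 ∷ 16 ∷ 48 ∷ 8 ∷ 40 ∷ 24 ∷ 56 ∷ 36 ∷ 52 ∷ 12 ∷ 44 ∷ 60 ∷ 2 ∷ 26 ∷ 58 ∷ 62 ∷ 33 ∷ 53 ∷ 39 ∷ 63 ∷ [])))
   (split 10 20 ((0 ∷ []) ∷ [])
   (split 47 16 []
   (clique (0 ∷ 32 ∷ 16 ∷ 48 ∷ 8 ∷ 40 ∷ 24 ∷ 56 ∷ 36 ∷ 52 ∷ 12 ∷ 44 ∷ 60 ∷ 2 ∷ 1 ∷ 41 ∷ 57 ∷ 37 ∷ 45 ∷ 61 ∷ 39 ∷ []))
   (clique (0 ∷ 32 ∷ 16 ∷ 48 ∷ 8 ∷ 40 ∷ 24 ∷ 56 ∷ 36 ∷ 12 ∷ 44 ∷ 60 ∷ 1 ∷ 41 ∷ 25 ∷ 57 ∷ 37 ∷ 61 ∷ 39 ∷ 47 ∷ 63 ∷ [])))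
   (split 8 21 ((0 ∷ []) ∷ [])
   (clique (0 ∷ 32 ∷ 16 ∷ 48 ∷ 8 ∷ 40 ∷ 24 ∷ 56 ∷ 36 ∷ 52 ∷ 12 ∷ 44 ∷ 60 ∷ 2 ∷ 34 ∷ 18 ∷ 42 ∷ 58 ∷ 14 ∷ 62 ∷ 63 ∷ []))
   (split 16 12 []
   (clique (0 ∷ 32 ∷ 16 ∷ 48 ∷ 8 ∷ 40 ∷ 24 ∷ 56 ∷ 36 ∷ 52 ∷ 60 ∷ 2 ∷ 34 ∷ 18 ∷ 50 ∷ 10 ∷ 42 ∷ 26 ∷ 58 ∷ 62 ∷ 63 ∷ []))
   (clique (0 ∷ 32 ∷ 16 ∷ 48 ∷ 40 ∷ 24 ∷ 56 ∷ 36 ∷ 44 ∷ 60 ∷ 2 ∷ 34 ∷ 18 ∷ 50 ∷ 42 ∷ 26 ∷ 58 ∷ 38 ∷ 62 ∷ 39 ∷ 63 ∷ []))))))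
   (split 20 34 ((0 ∷ 3 ∷ 4 ∷ []) ∷ (4 ∷ []) ∷ [])
   (split 8 48 []
   (clique (0 ∷ 32 ∷ 48 ∷ 40 ∷ 24 ∷ 56 ∷ 36 ∷ 20 ∷ 52 ∷ 44 ∷ 28 ∷ 60 ∷ 2 ∷ 50 ∷ 58 ∷ 38 ∷ 54 ∷ 46 ∷ 62 ∷ 39 ∷ 55 ∷ []))
   (split 47 16 []
   (clique (0 ∷ 32 ∷ 16 ∷ 48 ∷ 40 ∷ 24 ∷ 56 ∷ 36 ∷ 20 ∷ 52 ∷ 12 ∷ 44 ∷ 28 ∷ 60 ∷ 2 ∷ 46 ∷ 1 ∷ 57 ∷ 13 ∷ 45 ∷ 61 ∷ []))
   (clique (0 ∷ 32 ∷ 16 ∷ 40 ∷ 24 ∷ 56 ∷ 36 ∷ 20 ∷ 52 ∷ 12 ∷ 44 ∷ 28 ∷ 60 ∷ 38 ∷ 46 ∷ 1 ∷ 57 ∷ 61 ∷ 39 ∷ 47 ∷ 63 ∷ []))))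
   (split 22 8 ((0 ∷ 3 ∷ 4 ∷ []) ∷ (4 ∷ []) ∷ [])
   (clique (0 ∷ 32 ∷ 48 ∷ 8 ∷ 40 ∷ 56 ∷ 36 ∷ 20 ∷ 52 ∷ 12 ∷ 44 ∷ 60 ∷ 50 ∷ 58 ∷ 62 ∷ 1 ∷ 9 ∷ 41 ∷ 57 ∷ 45 ∷ 39 ∷ []))
   (split 23 32 ((3 ∷ 4 ∷ []) ∷ (4 ∷ []) ∷ [])
   (clique (0 ∷ 32 ∷ 8 ∷ 40 ∷ 24 ∷ 56 ∷ 36 ∷ 20 ∷ 12 ∷ 44 ∷ 28 ∷ 60 ∷ 2 ∷ 34 ∷ 10 ∷ 42 ∷ 26 ∷ 58 ∷ 22 ∷ 14 ∷ 30 ∷ []))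
   (clique (0 ∷ 32 ∷ 16 ∷ 48 ∷ 56 ∷ 36 ∷ 20 ∷ 52 ∷ 60 ∷ 2 ∷ 34 ∷ 18 ∷ 50 ∷ 58 ∷ 38 ∷ 22 ∷ 54 ∷ 62 ∷ 39 ∷ 23 ∷ 55 ∷ []))))))
   (split 56 6 ((0 ∷ []) ∷ [])
   (split 1 10 ((3 ∷ 4 ∷ []) ∷ [])
   (split 32 12 ((4 ∷ []) ∷ [])
   (clique (0 ∷ 32 ∷ 48 ∷ 24 ∷ 56 ∷ 4 ∷ 36 ∷ 20 ∷ 52 ∷ 60 ∷ 2 ∷ 34 ∷ 50 ∷ 10 ∷ 26 ∷ 58 ∷ 38 ∷ 54 ∷ 62 ∷ 25 ∷ 57 ∷ []))
   (split 36 8 ((4 ∷ []) ∷ [])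
   (clique (0 ∷ 32 ∷ 48 ∷ 8 ∷ 24 ∷ 56 ∷ 4 ∷ 12 ∷ 28 ∷ 60 ∷ 2 ∷ 34 ∷ 50 ∷ 10 ∷ 42 ∷ 26 ∷ 58 ∷ 14 ∷ 46 ∷ 62 ∷ 57 ∷ []))
   (clique (0 ∷ 32 ∷ 48 ∷ 56 ∷ 4 ∷ 36 ∷ 52 ∷ 44 ∷ 60 ∷ 2 ∷ 34 ∷ 10 ∷ 42 ∷ 58 ∷ 38 ∷ 14 ∷ 46 ∷ 62 ∷ 57 ∷ 39 ∷ 55 ∷ []))))
   (split 1 14 ((3 ∷ 4 ∷ []) ∷ [])
   (clique (0 ∷ 8 ∷ 40 ∷ 56 ∷ 4 ∷ 12 ∷ 44 ∷ 60 ∷ 2 ∷ 10 ∷ 42 ∷ 58 ∷ 14 ∷ 46 ∷ 62 ∷ 41 ∷ 57 ∷ 5 ∷ 15 ∷ 47 ∷ 63 ∷ []))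
   (split 1 26 ((3 ∷ 4 ∷ []) ∷ [])
   (clique (0 ∷ 16 ∷ 24 ∷ 56 ∷ 4 ∷ 20 ∷ 28 ∷ 60 ∷ 2 ∷ 18 ∷ 26 ∷ 58 ∷ 22 ∷ 30 ∷ 62 ∷ 49 ∷ 25 ∷ 57 ∷ 23 ∷ 31 ∷ 63 ∷ []))
   (split 1 30 ((3 ∷ 4 ∷ []) ∷ [])
   (clique (0 ∷ 32 ∷ 48 ∷ 56 ∷ 4 ∷ 36 ∷ 20 ∷ 52 ∷ 28 ∷ 60 ∷ 2 ∷ 18 ∷ 26 ∷ 58 ∷ 22 ∷ 30 ∷ 62 ∷ 49 ∷ 57 ∷ 5 ∷ 37 ∷ []))
   (clique (0 ∷ 32 ∷ 48 ∷ 56 ∷ 4 ∷ 36 ∷ 52 ∷ 60 ∷ 2 ∷ 34 ∷ 50 ∷ 58 ∷ 38 ∷ 54 ∷ 62 ∷ 33 ∷ 49 ∷ 57 ∷ 39 ∷ 55 ∷ 63 ∷ []))))))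
   (split 24 7 ((3 ∷ 4 ∷ []) ∷ [])
   (split 18 32 ((3 ∷ []) ∷ (0 ∷ []) ∷ [])
   (clique (0 ∷ 32 ∷ 8 ∷ 40 ∷ 24 ∷ 56 ∷ 4 ∷ 36 ∷ 44 ∷ 28 ∷ 60 ∷ 2 ∷ 10 ∷ 42 ∷ 58 ∷ 6 ∷ 38 ∷ 46 ∷ 62 ∷ 47 ∷ 63 ∷ []))
   (clique (0 ∷ 16 ∷ 24 ∷ 56 ∷ 4 ∷ 36 ∷ 20 ∷ 52 ∷ 28 ∷ 60 ∷ 2 ∷ 18 ∷ 50 ∷ 26 ∷ 58 ∷ 6 ∷ 38 ∷ 22 ∷ 54 ∷ 62 ∷ 55 ∷ [])))
   (split 7 56 []
   (split 20 32 ((3 ∷ 4 ∷ []) ∷ (4 ∷ []) ∷ [])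
   (clique (0 ∷ 32 ∷ 16 ∷ 48 ∷ 56 ∷ 4 ∷ 36 ∷ 52 ∷ 60 ∷ 2 ∷ 34 ∷ 18 ∷ 50 ∷ 58 ∷ 6 ∷ 38 ∷ 54 ∷ 62 ∷ 39 ∷ 55 ∷ 63 ∷ []))
   (split 20 34 ((0 ∷ 3 ∷ 4 ∷ []) ∷ (4 ∷ []) ∷ [])
   (clique (0 ∷ 32 ∷ 40 ∷ 24 ∷ 56 ∷ 4 ∷ 36 ∷ 20 ∷ 52 ∷ 44 ∷ 28 ∷ 60 ∷ 38 ∷ 46 ∷ 1 ∷ 57 ∷ 5 ∷ 61 ∷ 39 ∷ 47 ∷ 63 ∷ []))
   (split 22 8 ((0 ∷ 3 ∷ 4 ∷ []) ∷ (4 ∷ []) ∷ [])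
   (clique (0 ∷ 48 ∷ 8 ∷ 40 ∷ 56 ∷ 4 ∷ 36 ∷ 20 ∷ 52 ∷ 12 ∷ 44 ∷ 60 ∷ 50 ∷ 58 ∷ 6 ∷ 62 ∷ 9 ∷ 41 ∷ 5 ∷ 13 ∷ 45 ∷ []))
   (clique (0 ∷ 32 ∷ 48 ∷ 56 ∷ 4 ∷ 36 ∷ 20 ∷ 52 ∷ 60 ∷ 2 ∷ 34 ∷ 18 ∷ 50 ∷ 58 ∷ 6 ∷ 38 ∷ 22 ∷ 54 ∷ 62 ∷ 39 ∷ 55 ∷ [])))))
   (split 20 32 ((3 ∷ 4 ∷ []) ∷ (4 ∷ []) ∷ [])
   (split 38 16 ((0 ∷ []) ∷ [])
   (clique (0 ∷ 32 ∷ 16 ∷ 48 ∷ 56 ∷ 4 ∷ 36 ∷ 52 ∷ 60 ∷ 2 ∷ 34 ∷ 18 ∷ 50 ∷ 58 ∷ 6 ∷ 54 ∷ 62 ∷ 17 ∷ 7 ∷ 55 ∷ 63 ∷ []))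
   (split 38 24 ((0 ∷ []) ∷ [])
   (clique (0 ∷ 32 ∷ 16 ∷ 8 ∷ 40 ∷ 24 ∷ 56 ∷ 4 ∷ 36 ∷ 52 ∷ 44 ∷ 60 ∷ 2 ∷ 34 ∷ 18 ∷ 58 ∷ 6 ∷ 54 ∷ 62 ∷ 25 ∷ 7 ∷ []))
   (clique (0 ∷ 32 ∷ 40 ∷ 56 ∷ 4 ∷ 36 ∷ 44 ∷ 60 ∷ 2 ∷ 34 ∷ 42 ∷ 26 ∷ 58 ∷ 6 ∷ 38 ∷ 46 ∷ 62 ∷ 7 ∷ 39 ∷ 47 ∷ 63 ∷ []))))
   (split 20 34 ((0 ∷ 3 ∷ 4 ∷ []) ∷ (4 ∷ []) ∷ [])
   (clique (0 ∷ 32 ∷ 40 ∷ 56 ∷ 4 ∷ 36 ∷ 20 ∷ 52 ∷ 44 ∷ 28 ∷ 60 ∷ 38 ∷ 46 ∷ 1 ∷ 57 ∷ 5 ∷ 61 ∷ 7 ∷ 39 ∷ 47 ∷ 63 ∷ []))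
   (clique (0 ∷ 32 ∷ 48 ∷ 40 ∷ 56 ∷ 4 ∷ 36 ∷ 52 ∷ 44 ∷ 60 ∷ 2 ∷ 34 ∷ 50 ∷ 42 ∷ 58 ∷ 6 ∷ 38 ∷ 62 ∷ 7 ∷ 39 ∷ 63 ∷ []))))))))))))))
   -- From here on no element is the sum of two others. This is invariant under all permutations,
   -- which the two words again generate; the split asks whether s₀ + s₁ = s₂ + s₃.
   (split 3 12 ((1 ∷ 3 ∷ 4 ∷ []) ∷ (0 ∷ 2 ∷ []) ∷ [])
   (split 35 16 ((4 ∷ []) ∷ [])
   (split 50 8 ((1 ∷ 0 ∷ 2 ∷ 1 ∷ 2 ∷ []) ∷ [])
   (clique (0 ∷ 32 ∷ 16 ∷ 48 ∷ 8 ∷ 24 ∷ 4 ∷ 36 ∷ 20 ∷ 52 ∷ 12 ∷ 28 ∷ 60 ∷ 2 ∷ 34 ∷ 18 ∷ 38 ∷ 62 ∷ 17 ∷ 13 ∷ 63 ∷ []))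
   (split 26 32 ((1 ∷ 0 ∷ 2 ∷ 1 ∷ 2 ∷ []) ∷ [])
   (clique (0 ∷ 32 ∷ 16 ∷ 48 ∷ 24 ∷ 4 ∷ 36 ∷ 20 ∷ 52 ∷ 12 ∷ 28 ∷ 60 ∷ 2 ∷ 18 ∷ 10 ∷ 38 ∷ 22 ∷ 14 ∷ 62 ∷ 33 ∷ 17 ∷ []))
   (clique (0 ∷ 16 ∷ 8 ∷ 40 ∷ 24 ∷ 56 ∷ 12 ∷ 28 ∷ 60 ∷ 2 ∷ 34 ∷ 18 ∷ 50 ∷ 10 ∷ 42 ∷ 26 ∷ 58 ∷ 30 ∷ 62 ∷ 27 ∷ 59 ∷ []))))
   (split 32 13 ((1 ∷ 0 ∷ 2 ∷ 1 ∷ 2 ∷ []) ∷ (4 ∷ []) ∷ [])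
   (split 22 32 ((2 ∷ []) ∷ [])
   (clique (0 ∷ 32 ∷ 16 ∷ 48 ∷ 8 ∷ 40 ∷ 56 ∷ 12 ∷ 44 ∷ 28 ∷ 60 ∷ 34 ∷ 18 ∷ 50 ∷ 54 ∷ 62 ∷ 1 ∷ 33 ∷ 61 ∷ 59 ∷ 63 ∷ []))
   (split 24 34 ((2 ∷ []) ∷ [])
   (clique (0 ∷ 32 ∷ 16 ∷ 48 ∷ 40 ∷ 24 ∷ 56 ∷ 4 ∷ 36 ∷ 52 ∷ 12 ∷ 44 ∷ 28 ∷ 60 ∷ 50 ∷ 46 ∷ 1 ∷ 33 ∷ 49 ∷ 37 ∷ 45 ∷ []))
   (clique (0 ∷ 32 ∷ 16 ∷ 48 ∷ 8 ∷ 24 ∷ 12 ∷ 44 ∷ 28 ∷ 60 ∷ 2 ∷ 34 ∷ 18 ∷ 50 ∷ 58 ∷ 30 ∷ 62 ∷ 11 ∷ 27 ∷ 59 ∷ 63 ∷ []))))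
   (split 32 29 ((1 ∷ 0 ∷ 2 ∷ 1 ∷ 2 ∷ []) ∷ (4 ∷ []) ∷ [])
   (split 24 33 ((2 ∷ []) ∷ [])
   (clique (0 ∷ 32 ∷ 16 ∷ 24 ∷ 36 ∷ 12 ∷ 44 ∷ 28 ∷ 60 ∷ 2 ∷ 34 ∷ 50 ∷ 58 ∷ 22 ∷ 30 ∷ 62 ∷ 5 ∷ 21 ∷ 45 ∷ 7 ∷ 23 ∷ []))
   (clique (0 ∷ 32 ∷ 16 ∷ 48 ∷ 40 ∷ 24 ∷ 56 ∷ 44 ∷ 28 ∷ 60 ∷ 34 ∷ 50 ∷ 33 ∷ 17 ∷ 49 ∷ 25 ∷ 57 ∷ 61 ∷ 27 ∷ 59 ∷ 63 ∷ [])))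
   (split 47 16 ((4 ∷ []) ∷ [])
   (split 50 8 ((1 ∷ 0 ∷ 2 ∷ 1 ∷ 2 ∷ []) ∷ [])
   (clique (0 ∷ 32 ∷ 16 ∷ 48 ∷ 8 ∷ 24 ∷ 4 ∷ 20 ∷ 52 ∷ 12 ∷ 44 ∷ 28 ∷ 60 ∷ 2 ∷ 18 ∷ 38 ∷ 46 ∷ 62 ∷ 17 ∷ 13 ∷ 39 ∷ []))
   (split 2 13 ((1 ∷ 0 ∷ 2 ∷ 1 ∷ 2 ∷ []) ∷ [])
   (clique (0 ∷ 32 ∷ 16 ∷ 8 ∷ 24 ∷ 56 ∷ 12 ∷ 44 ∷ 28 ∷ 60 ∷ 2 ∷ 34 ∷ 18 ∷ 50 ∷ 10 ∷ 42 ∷ 58 ∷ 46 ∷ 30 ∷ 62 ∷ 1 ∷ []))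
   (clique (0 ∷ 32 ∷ 16 ∷ 8 ∷ 40 ∷ 24 ∷ 12 ∷ 44 ∷ 28 ∷ 60 ∷ 2 ∷ 10 ∷ 14 ∷ 1 ∷ 9 ∷ 13 ∷ 11 ∷ 43 ∷ 27 ∷ 59 ∷ 63 ∷ []))))
   (split 15 16 ((4 ∷ []) ∷ [])
   (split 17 36 ((1 ∷ 0 ∷ 2 ∷ 1 ∷ 2 ∷ []) ∷ [])
   (clique (0 ∷ 32 ∷ 16 ∷ 48 ∷ 24 ∷ 56 ∷ 36 ∷ 20 ∷ 52 ∷ 12 ∷ 44 ∷ 28 ∷ 60 ∷ 18 ∷ 50 ∷ 54 ∷ 14 ∷ 46 ∷ 62 ∷ 29 ∷ 31 ∷ []))
   (clique (0 ∷ 32 ∷ 16 ∷ 48 ∷ 8 ∷ 40 ∷ 24 ∷ 56 ∷ 12 ∷ 44 ∷ 28 ∷ 60 ∷ 14 ∷ 46 ∷ 13 ∷ 45 ∷ 11 ∷ 43 ∷ 27 ∷ 31 ∷ 63 ∷ [])))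
   (clique (0 ∷ 32 ∷ 16 ∷ 48 ∷ 8 ∷ 40 ∷ 24 ∷ 56 ∷ 44 ∷ 28 ∷ 60 ∷ 58 ∷ 62 ∷ 57 ∷ 61 ∷ 43 ∷ 27 ∷ 59 ∷ 47 ∷ 31 ∷ 63 ∷ [])))))))
   -- Disjoint pairs have distinct sums as well, so 0, the six elements and all fifteen sums of
   -- pairs are distinct; listed are all of these 22 except s₀ + s₁.
   (clique (0 ∷ 32 ∷ 16 ∷ 48 ∷ 8 ∷ 40 ∷ 24 ∷ 4 ∷ 36 ∷ 20 ∷ 12 ∷ 2 ∷ 34 ∷ 18 ∷ 10 ∷ 6 ∷ 1 ∷ 33 ∷ 17 ∷ 9 ∷ 5 ∷ [])))

-- The whole case analysis is carried out here, by evaluation during type checking.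
certificate-checked : check certificate (trivial 6) (initial 6) ≡ true
certificate-checked = ≡.refl

theorem1p3 : ∀ {c ℓ : Level} (G : AbelianGroup c ℓ) (s : Vec (AbelianGroup.Carrier G) 6) →
    Over.Distinct G s → Over.ZeroSumFree G s →
    (Over.HasSize G (Over.InΣ G s) 19 ⇔ Over.OneOfCases G s)
theorem1p3 G s distinct zsf = mk⇔
  (extremal⇒case certificate certificate-checked s distinct zsf)
  (case⇒extremal sizes-checked s distinct zsf)
  where open Soundness G
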